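{- There exists an algorithm which, given a finite argumentation framework $F=\langle\mathcal{A},\mathcal{R}\rangle$ together with the family $\mathrm{IRR}(F)$ of its irreducible self-defending sets, enumerates $\mathrm{PREF}(F)$ with polynomial delay and polynomial space in the size of $\mathrm{IRR}(F)$ and $F$.
   Context: All objects are finite. An argumentation framework is a pair $F=\langle \mathcal{A},\mathcal{R}\rangle$ where $\mathcal{A}$ is a finite set (of arguments) and $\mathcal{R}\subseteq\mathcal{A}\times\mathcal{A}$ (attacks; self-attacks are allowed). For $S\subseteq\mathcal{A}$: $S^+=\{x\in\mathcal{A}\mid \exists y\in S,\ (y,x)\in\mathcal{R}\}$ and $S^-=\{x\in\mathcal{A}\mid \exists y\in S,\ (x,y)\in\mathcal{R}\}$. A set $S\subseteq\mathcal{A}$ is conflict-free if $S\cap S^+=\emptyset$, self-defending if $S^-\subseteq S^+$, and admissible if it is both; $\mathrm{SD}(F)$ is the family of self-defending sets. Preferred extensions are the inclusion-wise maximal admissible sets, forming the family $\mathrm{PREF}(F)$. A self-defending set $S\in\mathrm{SD}(F)$ with $S\neq\emptyset$ is irreducible if for all $S_1,S_2\in\mathrm{SD}(F)$, $S=S_1\cup S_2$ implies $S=S_1$ or $S=S_2$; $\mathrm{IRR}(F)$ is the family of irreducible self-defending sets. An enumeration algorithm with input $x$ outputs all the elements of a solution set $R(x)$, each exactly once. It has polynomial delay if the time between two consecutive outputs, and the time after the last output, is bounded by a polynomial in the size of $x$; it uses polynomial space if the space used is bounded by a polynomial in the size of $x$. Here the input $x$ consists of $F$ and $\mathrm{IRR}(F)$.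 -}

module Defs where

open import Data.Bool using (Bool; true; false)
open import Data.Fin using (Fin; zero)
open import Data.Fin.Subset using (Subset; _∈_; _⊆_; _∪_; ⊥)
open import Data.List using (List; []; _∷_; _++_; [_]; map; foldr)
import Data.List.Membership.Propositional as List
open import Data.List.Relation.Unary.All using (All)
open import Data.List.Relation.Unary.Unique.Propositional using (Unique)
open import Data.Nat using (ℕ; suc; _+_; _*_; _≤_)
open import Data.Product using (Σ-syntax; ∃-syntax; _×_; _,_)
open import Data.Sum using (_⊎_)
open import Data.Vec using (Vec; toList; lookup; replicate; _[_]≔_)
import Data.Vec as Vec
open import Function.Bundles using (_⇔_)
open import Level using (0ℓ)
open import Relation.Binary.PropositionalEquality using (_≡_; _≢_)
import Relation.Unary as U
open U using (Pred)

------------------------------------------------------------------------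
-- Argumentation frameworks

-- The arguments are Fin n.  The attack relation is a Boolean matrix given by
-- rows: x ∈ attackedBy y means that y attacks x.
record AF : Set where
  field
    n          : ℕ
    attackedBy : Vec (Subset n) n

  Arg : Set
  Arg = Fin n

  _⇝_ : Arg → Arg → Set
  y ⇝ x = x ∈ lookup attackedBy y

  _⁺ : Subset n → Pred Arg 0ℓ
  (S ⁺) x = ∃[ y ] (y ∈ S × y ⇝ x)

  _⁻ : Subset n → Pred Arg 0ℓ
  (S ⁻) x = ∃[ y ] (y ∈ S × x ⇝ y)

  ConflictFree : Pred (Subset n) 0ℓ
  ConflictFree S = U.Empty ((_∈ S) U.∩ (S ⁺))

  SelfDefending : Pred (Subset n) 0ℓ
  SelfDefending S = (S ⁻) U.⊆ (S ⁺)

  Admissible : Pred (Subset n) 0ℓ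
  Admissible S = ConflictFree S × SelfDefending S

  Preferred : Pred (Subset n) 0ℓ
  Preferred S = Admissible S × (∀ T → Admissible T → S ⊆ T → S ≡ T)

  Irreducible : Pred (Subset n) 0ℓ
  Irreducible S =
    SelfDefending S × S ≢ ⊥ ×
    (∀ S₁ S₂ → SelfDefending S₁ → SelfDefending S₂ →
       S ≡ S₁ ∪ S₂ → S ≡ S₁ ⊎ S ≡ S₂)

infix 4 _Lists_

_Lists_ : {A : Set} → List A → Pred A 0ℓ → Set
xs Lists P = Unique xs × (∀ x → x List.∈ xs ⇔ P x)

------------------------------------------------------------------------
-- The model of computation: Jones's WHILE language (N. D. Jones,
-- "Computability and Complexity from a Programming Perspective"), whose
-- only data are binary trees, extended with an output command.

data 𝔻 : Set where
  nil  : 𝔻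
  cons : 𝔻 → 𝔻 → 𝔻

∣_∣ : 𝔻 → ℕ
∣ nil ∣      = 1
∣ cons d e ∣ = suc (∣ d ∣ + ∣ e ∣)

hd tl : 𝔻 → 𝔻
hd nil        = nil
hd (cons d _) = d
tl nil        = nil
tl (cons _ e) = e

infix 8 _≔_
infixr 6 _⨾_

data Expr (k : ℕ) : Set where
  var     : Fin k → Expr k
  `nil    : Expr k
  `cons   : Expr k → Expr k → Expr k
  `hd `tl : Expr k → Expr k

data Cmd (k : ℕ) : Set where
  skip          : Cmd k
  _≔_           : Fin k → Expr k → Cmd k
  _⨾_           : Cmd k → Cmd k → Cmd k
  if_then_else_ : Expr k → Cmd k → Cmd k → Cmd k
  while_loop_   : Expr k → Cmd k → Cmd k
  output        : Expr k → Cmd k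

Store : ℕ → Set
Store k = Vec 𝔻 k

storeSize : ∀ {k} → Store k → ℕ
storeSize σ = Vec.sum (Vec.map ∣_∣ σ)

⟦_⟧ : ∀ {k} → Expr k → Store k → 𝔻
⟦ var x ⟧     σ = lookup σ x
⟦ `nil ⟧      σ = nil
⟦ `cons e f ⟧ σ = cons (⟦ e ⟧ σ) (⟦ f ⟧ σ)
⟦ `hd e ⟧     σ = hd (⟦ e ⟧ σ)
⟦ `tl e ⟧     σ = tl (⟦ e ⟧ σ)

evalTime : ∀ {k} → Expr k → ℕ
evalTime (var _)     = 1
evalTime `nil        = 1
evalTime (`cons e f) = suc (evalTime e + evalTime f)
evalTime (`hd e)     = suc (evalTime e)
evalTime (`tl e)     = suc (evalTime e)

-- A run is observed as a sequence of stretches of computation, each with the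
-- time it takes and the space in use, and of emitted outputs.
data Event : Set where
  work : (time space : ℕ) → Event
  emit : 𝔻 → Event

Trace : Set
Trace = List Event

-- Every tree operation and every command takes one unit of time.  Space is
-- the number of tree nodes, counted without sharing: a subtree occurring in
-- several variables is counted several times.  So, up to a factor depending
-- only on the program, a step acts on at most `space` nodes, and time and
-- space are jointly polynomially related to those of Turing machines.
-- Emitted trees are not kept, so they do not count towards space.
evaluating : ∀ {k} → Expr k → Store k → Event
evaluating e σ = work (suc (evalTime e)) (storeSize σ + ∣ ⟦ e ⟧ σ ∣)

infix 4 ⟨_,_⟩⇓⟨_,_⟩

data ⟨_,_⟩⇓⟨_,_⟩ {k : ℕ} : Cmd k → Store k → Trace → Store k → Set where
  ⇓-skip   : ∀ {σ} →
             ⟨ skip , σ ⟩⇓⟨ [ work 1 (storeSize σ) ] , σ ⟩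
  ⇓-assign : ∀ {x e σ} →
             ⟨ x ≔ e , σ ⟩⇓⟨ [ evaluating e σ ] , σ [ x ]≔ ⟦ e ⟧ σ ⟩
  ⇓-seq    : ∀ {c d σ σ′ σ″ τ τ′} →
             ⟨ c , σ ⟩⇓⟨ τ , σ′ ⟩ → ⟨ d , σ′ ⟩⇓⟨ τ′ , σ″ ⟩ →
             ⟨ c ⨾ d , σ ⟩⇓⟨ τ ++ τ′ , σ″ ⟩
  ⇓-then   : ∀ {e c d σ σ′ τ} →
             ⟦ e ⟧ σ ≢ nil → ⟨ c , σ ⟩⇓⟨ τ , σ′ ⟩ →
             ⟨ if e then c else d , σ ⟩⇓⟨ evaluating e σ ∷ τ , σ′ ⟩
  ⇓-else   : ∀ {e c d σ σ′ τ} →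
             ⟦ e ⟧ σ ≡ nil → ⟨ d , σ ⟩⇓⟨ τ , σ′ ⟩ →
             ⟨ if e then c else d , σ ⟩⇓⟨ evaluating e σ ∷ τ , σ′ ⟩
  ⇓-exit   : ∀ {e c σ} →
             ⟦ e ⟧ σ ≡ nil →
             ⟨ while e loop c , σ ⟩⇓⟨ [ evaluating e σ ] , σ ⟩
  ⇓-loop   : ∀ {e c σ σ′ σ″ τ τ′} →
             ⟦ e ⟧ σ ≢ nil → ⟨ c , σ ⟩⇓⟨ τ , σ′ ⟩ →
             ⟨ while e loop c , σ′ ⟩⇓⟨ τ′ , σ″ ⟩ →
             ⟨ while e loop c , σ ⟩⇓⟨ evaluating e σ ∷ τ ++ τ′ , σ″ ⟩
  ⇓-output : ∀ {e σ} →
             ⟨ output e , σ ⟩⇓⟨ evaluating e σ ∷ emit (⟦ e ⟧ σ) ∷ [] , σ ⟩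

record Program : Set where
  field
    {extraVars} : ℕ
    body        : Cmd (suc extraVars)

-- The input is placed in variable zero; all other variables start as nil.
infix 4 _on_⇓_

_on_⇓_ : Program → 𝔻 → Trace → Set
P on d ⇓ τ = ∃[ σ ] ⟨ body , d Vec.∷ replicate extraVars nil ⟩⇓⟨ τ , σ ⟩
  where open Program P

outputs : Trace → List 𝔻
outputs []             = []
outputs (work _ _ ∷ τ) = outputs τ
outputs (emit d ∷ τ)   = d ∷ outputs τ

-- The time before the first output, between each two consecutive outputs and
-- after the last one; the accumulator is the time since the last output.
delaysFrom : ℕ → Trace → List ℕ
delaysFrom t []             = [ t ]
delaysFrom t (work s _ ∷ τ) = delaysFrom (t + s) τ
delaysFrom t (emit _ ∷ τ)   = t ∷ delaysFrom 0 τ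

delays : Trace → List ℕ
delays = delaysFrom 0

spaces : Trace → List ℕ
spaces []             = []
spaces (work _ s ∷ τ) = s ∷ spaces τ
spaces (emit _ ∷ τ)   = spaces τ

------------------------------------------------------------------------
-- Enumeration problems

record EnumerationProblem : Set₁ where
  field
    Input          : Set
    Output         : Input → Set
    IsSolution     : ∀ x → Pred (Output x) 0ℓ
    encodeInput    : Input → 𝔻
    encodeOutput   : ∀ x → Output x → 𝔻

  inputSize : Input → ℕ
  inputSize x = ∣ encodeInput x ∣

-- A univariate polynomial over ℕ, lowest coefficient first.
Polynomial : Set
Polynomial = List ℕ

evalPoly : Polynomial → ℕ → ℕ
evalPoly p x = foldr (λ a r → a + x * r) 0 p

module _ (P : Program) (Q : EnumerationProblem) where
  open EnumerationProblem Q

  -- In particular P halts on every input.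
  Enumerates : Set
  Enumerates =
    ∀ x → ∃[ τ ] (P on encodeInput x ⇓ τ ×
      ∃[ ys ] (ys Lists IsSolution x × outputs τ ≡ map (encodeOutput x) ys))

  PolynomialDelay : Set
  PolynomialDelay =
    Σ[ p ∈ Polynomial ] (∀ x τ → P on encodeInput x ⇓ τ →
      All (_≤ evalPoly p (inputSize x)) (delays τ))

  PolynomialSpace : Set
  PolynomialSpace =
    Σ[ p ∈ Polynomial ] (∀ x τ → P on encodeInput x ⇓ τ →
      All (_≤ evalPoly p (inputSize x)) (spaces τ))

------------------------------------------------------------------------
-- Enumerating PREF(F) from F and IRR(F)

encodeList : List 𝔻 → 𝔻
encodeList = foldr cons nil

encodeBool : Bool → 𝔻
encodeBool false = nil
encodeBool true  = cons nil nil

encodeSubset : ∀ {n} → Subset n → 𝔻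
encodeSubset S = encodeList (map encodeBool (toList S))

encodeAF : AF → 𝔻
encodeAF F = encodeList (map encodeSubset (toList (AF.attackedBy F)))

-- The family IRR(F) may be listed in any order.
record AFWithIrr : Set where
  field
    F   : AF
    irr : List (Subset (AF.n F))
    irr-lists : irr Lists AF.Irreducible F

PrefFromIrr : EnumerationProblem
PrefFromIrr = record
  { Input        = AFWithIrr
  ; Output       = λ x → Subset (AF.n (F x))
  ; IsSolution   = λ x → AF.Preferred (F x)
  ; encodeInput  = λ x → cons (encodeAF (F x)) (encodeList (map encodeSubset (irr x)))
  ; encodeOutput = λ _ → encodeSubset
  }
  where open AFWithIrr

{-# OPTIONS --safe #-}

-- Self-defending sets are exactly the unions of irreducible ones, and a union
-- of sets is conflict-free iff no two of them, equal or not, are in conflict.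
-- So the preferred extensions are the maximal conflict-free unions of members of
-- IRR(F), and these are enumerated as by Tsukiyama et al.: the nodes at depth i
-- of a tree are the maximal conflict-free unions S for the first i members.
-- For the next member J, the children of S are S itself, if J is in conflict
-- with it, and N, the union of J with the members inside S compatible with J,
-- provided that N is maximal and S is the greedy completion of what N keeps of
-- S.  Every node has exactly one parent and at least one child, so a
-- depth-first traversal with an explicit stack outputs each leaf once, with
-- polynomially many steps in between and polynomially many pending nodes.
--
-- The conditions used are formulas whose quantifiers range over the entries of
-- given lists; such formulas are compiled to programs whose running time is
-- polynomial by construction.
module Submission where

open import Defs
open import Data.Bool using (Bool; true; false) renaming (if_then_else_ to ifᵇ_then_else_)
import Data.Empty as Empty
open import Data.Empty using (⊥-elim)
open import Data.Fin using (Fin; zero; suc; toℕ; fromℕ<)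
open import Data.Fin.Patterns using (0F; 1F; 2F; 3F; 4F)
open import Data.Fin.Properties using (any?; all?; toℕ-fromℕ<)
open import Data.Fin.Subset using (Subset; _∈_; _⊆_; _∪_; ⊥; ⋃) renaming (∣_∣ to cardinality)
open import Data.Fin.Subset.Properties
  using (_∈?_; _⊆?_; _⊂?_; ⊆-antisym; x∈p∪q⁺; x∈p∪q⁻; ∉⊥; anySubset?; p⊂q⇒∣p∣<∣q∣)
open import Data.List using (List; []; _∷_; _++_; map; filter; length; drop; reverse; _ʳ++_)
import Data.List.Membership.Propositional as List
open import Data.List.Membership.Propositional using (lose; find)
open import Data.List.Membership.Propositional.Properties using (∈-++⁺ˡ; ∈-++⁺ʳ; ∈-++⁻)
open import Data.List.Properties using (++-assoc; ++-identityʳ; map-++; length-map; length-drop; drop-all)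
import Data.List.Relation.Unary.All as List
open import Data.List.Relation.Unary.All using ([]; _∷_)
open import Data.List.Relation.Unary.AllPairs using ([]; _∷_)
open import Data.List.Relation.Unary.Any as Any using (Any; here; there)
open import Data.List.Relation.Unary.Any.Properties using (reverse⁺; reverse⁻)
open import Data.List.Relation.Unary.Unique.Propositional using (Unique)
import Data.List.Relation.Unary.Unique.Propositional.Properties as Unique
open import Data.Nat using (ℕ; zero; suc; _+_; _*_; _≤_; _<_; z≤n; s≤s)
open import Data.Nat.Induction using (<-wellFounded)
open import Data.Nat.Properties
open import Data.Nat.Solver using (module +-*-Solver)
open import Data.Product using (Σ-syntax; ∃-syntax; _×_; _,_; proj₁; proj₂)
open import Data.Product.Function.NonDependent.Propositional using (_×-⇔_)
open import Data.Sum using (_⊎_; inj₁; inj₂; [_,_]′; swap)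
open import Data.Sum.Function.Propositional using (_⊎-⇔_)
open import Data.Vec using (Vec; []; _∷_; lookup; toList; replicate; here; there; _[_]≔_)
open import Data.Vec.Properties using ([]=⇒lookup; lookup⇒[]=; length-toList)
open import Data.Vec.Relation.Unary.All using (All; []; _∷_)
open import Data.Vec.Relation.Unary.All.Properties using (lookup⁺)
open import Function using (_∘_; id)
open import Function.Bundles using (_⇔_; mk⇔; Equivalence)
open import Function.Properties.Equivalence using () renaming (trans to ⇔-trans)
open import Function.Related.TypeIsomorphisms using (¬-cong-⇔)
open import Induction.WellFounded using (Acc; acc)
open import Level using (0ℓ)
open import Relation.Binary using (Rel; Symmetric; Decidable)
open import Relation.Binary.PropositionalEquality using (_≡_; _≢_; refl; sym; trans; cong; cong₂; subst; subst₂)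
open import Relation.Nullary using (¬_; Dec; yes; no; does; contradiction)
open import Relation.Nullary.Decidable using (¬?; _×-dec_; _⊎-dec_; _→-dec_; decidable-stable; map′)
import Relation.Unary as U

-- Maximal conflict-free unions

-- Two obstacles shape the formulation. The program must recognise canonical nodes without running
-- the greedy completion: that the completion yields `S` is therefore stated as a condition on each
-- member and the members behind it in the list, with witnesses taken from inside `S`. Such a
-- condition is a bounded formula. The other obstacle is the cost model, which counts trees without
-- sharing, so every pending node pays for its own copy of the processed and the remaining members.
-- Passing to a child only moves `J` from one family to the other, so the joint size of the two
-- families is the same at all nodes; and at most one sibling per level is pending. Hence every tree
-- in the store stays quadratic in the input. The delay is bounded because a visited node either is
-- output or gets a child one level deeper: without dead ends, the number of visits between two
-- outputs is at most the number of levels.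

data AllTails {A : Set} (Q : A → List A → Set) : List A → Set where
  []  : AllTails Q []
  _∷_ : ∀ {x xs} → Q x xs → AllTails Q xs → AllTails Q (x ∷ xs)

allTails? : ∀ {A : Set} {Q : A → List A → Set} → (∀ x xs → Dec (Q x xs)) →
            U.Decidable (AllTails Q)
allTails? Q? []       = yes []
allTails? Q? (x ∷ xs) =
  map′ (λ { (q , qs) → q ∷ qs }) (λ { (q ∷ qs) → q , qs }) (Q? x xs ×-dec allTails? Q? xs)

allTails-∈ : ∀ {A : Set} {Q : A → List A → Set} {xs x} →
             AllTails Q xs → x List.∈ xs → ∃[ ys ] Q x ys
allTails-∈ (q ∷ _)  (here refl) = _ , q
allTails-∈ (_ ∷ qs) (there x∈)  = allTails-∈ qs x∈

module _ {n : ℕ} {Q : Subset n → Set} (Q? : U.Decidable Q) where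

  ∈-⋃-filter⁺ : ∀ {us x} → Any (λ u → Q u × x ∈ u) us → x ∈ ⋃ (filter Q? us)
  ∈-⋃-filter⁺ {u ∷ us} x∈ with Q? u | x∈
  ... | yes _ | here (_ , x∈u) = x∈p∪q⁺ (inj₁ x∈u)
  ... | yes _ | there x∈us     = x∈p∪q⁺ (inj₂ (∈-⋃-filter⁺ x∈us))
  ... | no ¬q | here (q , _)   = contradiction q ¬q
  ... | no _  | there x∈us     = ∈-⋃-filter⁺ x∈us

  ∈-⋃-filter⁻ : ∀ us {x} → x ∈ ⋃ (filter Q? us) → Any (λ u → Q u × x ∈ u) us
  ∈-⋃-filter⁻ [] x∈ = contradiction x∈ ∉⊥
  ∈-⋃-filter⁻ (u ∷ us) x∈ with Q? u
  ... | no _  = there (∈-⋃-filter⁻ us x∈)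
  ... | yes q with x∈p∪q⁻ u _ x∈
  ...   | inj₁ x∈u = here (q , x∈u)
  ...   | inj₂ x∈⋃ = there (∈-⋃-filter⁻ us x∈⋃)

module MaximalUnions {n : ℕ} (_~_ : Rel (Fin n) 0ℓ) (~-sym : Symmetric _~_)
                     (_~?_ : Decidable _~_) where

  infix 4 _#_ _#?_

  _#_ : Rel (Subset n) 0ℓ
  A # B = ∃[ x ] ∃[ y ] (x ∈ A × y ∈ B × x ~ y)

  _#?_ : Decidable _#_
  A #? B = any? λ x → any? λ y → x ∈? A ×-dec y ∈? B ×-dec x ~? y

  #-sym : Symmetric _#_
  #-sym (x , y , x∈A , y∈B , x~y) = y , x , y∈B , x∈A , ~-sym x~y

  #-mono : ∀ {A A′ B B′} → A ⊆ A′ → B ⊆ B′ → A # B → A′ # B′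
  #-mono A⊆ B⊆ (x , y , x∈A , y∈B , x~y) = x , y , A⊆ x∈A , B⊆ y∈B , x~y

  #-∪⁻ : ∀ {A} B C → A # B ∪ C → A # B ⊎ A # C
  #-∪⁻ B C (x , y , x∈A , y∈ , x~y) with x∈p∪q⁻ B C y∈
  ... | inj₁ y∈B = inj₁ (x , y , x∈A , y∈B , x~y)
  ... | inj₂ y∈C = inj₂ (x , y , x∈A , y∈C , x~y)

  ∪-independent : ∀ A B → ¬ A # A → ¬ B # B → ¬ A # B → ¬ (A ∪ B) # (A ∪ B)
  ∪-independent A B ¬AA ¬BB ¬AB c with #-∪⁻ A B c
  ... | inj₁ c₁ = [ ¬AA , ¬AB ]′ (#-∪⁻ A B (#-sym c₁))
  ... | inj₂ c₂ = [ ¬AB ∘ #-sym , ¬BB ]′ (#-∪⁻ A B (#-sym c₂))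

  -- Testing single members suffices for maximality: a larger conflict-free union contains a member
  -- not inside `S`, and this member alone already conflicts neither with itself nor with `S`. No
  -- quantification over unions remains.
  record Maximal (P : List (Subset n)) (S : Subset n) : Set where
    field
      independent : ¬ S # S
      covered     : ∀ {x} → x ∈ S → Any (λ u → u ⊆ S × x ∈ u) P
      saturated   : ∀ {u} → u List.∈ P → ¬ u # u → ¬ u # S → u ⊆ S
  open Maximal

  maximal-[] : Maximal [] ⊥
  maximal-[] .independent (_ , _ , x∈⊥ , _) = ∉⊥ x∈⊥
  maximal-[] .covered x∈⊥ = contradiction x∈⊥ ∉⊥
  maximal-[] .saturated ()

  maximal-[]⁻ : ∀ {S} → Maximal [] S → S ≡ ⊥
  maximal-[]⁻ m = ⊆-antisym (λ x∈S → contradiction (covered m x∈S) λ ()) (λ x∈⊥ → contradiction x∈⊥ ∉⊥)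

  Kept : Subset n → Subset n → Subset n → Set
  Kept S J u = u ⊆ S × ¬ u # J

  kept? : ∀ S J → U.Decidable (Kept S J)
  kept? S J u = u ⊆? S ×-dec ¬? (u #? J)

  Exchanged : List (Subset n) → Subset n → Subset n → Fin n → Set
  Exchanged P S J x = x ∈ J ⊎ Any (λ u → Kept S J u × x ∈ u) P

  abstract
    exchange : List (Subset n) → Subset n → Subset n → Subset n
    exchange P S J = J ∪ ⋃ (filter (kept? S J) P)

    ∈-exchange⁺ : ∀ P S J {x} → Exchanged P S J x → x ∈ exchange P S J
    ∈-exchange⁺ P S J (inj₁ x∈J) = x∈p∪q⁺ (inj₁ x∈J)
    ∈-exchange⁺ P S J (inj₂ x∈)  = x∈p∪q⁺ (inj₂ (∈-⋃-filter⁺ (kept? S J) x∈))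

    ∈-exchange⁻ : ∀ P S J {x} → x ∈ exchange P S J → Exchanged P S J x
    ∈-exchange⁻ P S J x∈ with x∈p∪q⁻ J _ x∈
    ... | inj₁ x∈J = inj₁ x∈J
    ... | inj₂ x∈⋃ = inj₂ (∈-⋃-filter⁻ (kept? S J) P x∈⋃)

  J⊆exchange : ∀ {P S J} → J ⊆ exchange P S J
  J⊆exchange x∈J = ∈-exchange⁺ _ _ _ (inj₁ x∈J)

  -- A self-conflicting `J` counts as a clash with every `S`: it admits no exchanged child, so `S`
  -- has to survive unchanged.
  Clash : Subset n → Subset n → Set
  Clash S J = J # J ⊎ S # J

  -- A set u outside S must not fit into N = exchange P S J, so that N is
  -- maximal, and must be refused when the kept sets are completed greedily
  -- along the list read from its end, where us precedes u; so this completion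
  -- is S, which is thereby determined by N.
  Rejected : List (Subset n) → Subset n → Subset n → Subset n → List (Subset n) → Set
  Rejected P S J u us =
    u ⊆ S ⊎ u # u ⊎
    (u # exchange P S J ×
     (Any (λ w → Kept S J w × w # u) P ⊎ Any (λ w → w ⊆ S × w # u) us))

  Canonical : List (Subset n) → Subset n → Subset n → Set
  Canonical P S J = ¬ J # J × AllTails (Rejected P S J) P

  rejected? : ∀ P S J u us → Dec (Rejected P S J u us)
  rejected? P S J u us =
    u ⊆? S ⊎-dec u #? u ⊎-dec
    (u #? exchange P S J ×-dec
     (Any.any? (λ w → kept? S J w ×-dec w #? u) P ⊎-dec Any.any? (λ w → w ⊆? S ×-dec w #? u) us))

  abstract
    canonical? : ∀ P S J → Dec (Canonical P S J)
    canonical? P S J = ¬? (J #? J) ×-dec allTails? (rejected? P S J) P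

    clash? : ∀ S J → Dec (Clash S J)
    clash? S J = J #? J ⊎-dec S #? J

  kept⊆exchange : ∀ {P S J u} → u List.∈ P → Kept S J u → u ⊆ exchange P S J
  kept⊆exchange u∈P k x∈u = ∈-exchange⁺ _ _ _ (inj₂ (lose u∈P (k , x∈u)))

  -- Excludes dead ends in the search. Without a clash all members inside `S` are kept, so the
  -- exchanged set contains `S`. A member outside `S` without internal conflict conflicts with some
  -- element of `S` by saturation, and a kept set covers that element.
  ¬clash⇒canonical : ∀ {P S J} → Maximal P S → ¬ Clash S J → Canonical P S J
  ¬clash⇒canonical {P} {S} {J} m ¬clash = ¬clash ∘ inj₁ , go P id
    where
    ¬SJ : ¬ S # J
    ¬SJ = ¬clash ∘ inj₂
    S⊆N : S ⊆ exchange P S J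
    S⊆N x∈S =
      let u , u∈P , u⊆S , x∈u = find (covered m x∈S)
      in kept⊆exchange u∈P (u⊆S , ¬SJ ∘ #-mono u⊆S id) x∈u
    rejects : ∀ u → u List.∈ P → ∀ us → Rejected P S J u us
    rejects u u∈P us with u ⊆? S | u #? u | u #? S
    ... | yes u⊆S | _      | _     = inj₁ u⊆S
    ... | no _    | yes uu | _     = inj₂ (inj₁ uu)
    ... | no u⊈S  | no ¬uu | no ¬uS = ⊥-elim (u⊈S (saturated m u∈P ¬uu ¬uS))
    ... | no _    | no _   | yes uS@(x , y , x∈u , y∈S , x~y) =
      inj₂ (inj₂ (#-mono id S⊆N uS , inj₁ (Any.map found (covered m y∈S))))
      where
      found : ∀ {w} → w ⊆ S × y ∈ w → Kept S J w × w # u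
      found (w⊆S , y∈w) = (w⊆S , ¬SJ ∘ #-mono w⊆S id) , (y , x , y∈w , x∈u , ~-sym x~y)
    go : ∀ us → (∀ {u} → u List.∈ us → u List.∈ P) → AllTails (Rejected P S J) us
    go []       _   = []
    go (u ∷ us) us⊆ = rejects u (us⊆ (here refl)) us ∷ go us (us⊆ ∘ there)

  data Child (P : List (Subset n)) (J S : Subset n) : Subset n → Set where
    unchanged : Clash S J → Child P J S S
    exchanged : Canonical P S J → Child P J S (exchange P S J)

  exchange-independent : ∀ {P S J} → ¬ S # S → ¬ J # J → ¬ exchange P S J # exchange P S J
  exchange-independent {P} {S} {J} ¬SS ¬JJ (x , y , x∈ , y∈ , x~y)
    with ∈-exchange⁻ P S J x∈ | ∈-exchange⁻ P S J y∈
  ... | inj₁ x∈J | inj₁ y∈J = ¬JJ (x , y , x∈J , y∈J , x~y)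
  ... | inj₁ x∈J | inj₂ y∈P =
    let _ , _ , (_ , ¬uJ) , y∈u = find y∈P in ¬uJ (y , x , y∈u , x∈J , ~-sym x~y)
  ... | inj₂ x∈P | inj₁ y∈J =
    let _ , _ , (_ , ¬uJ) , x∈u = find x∈P in ¬uJ (x , y , x∈u , y∈J , x~y)
  ... | inj₂ x∈P | inj₂ y∈P =
    let _ , _ , (u⊆S , _) , x∈u = find x∈P
        _ , _ , (w⊆S , _) , y∈w = find y∈P
    in ¬SS (x , y , u⊆S x∈u , w⊆S y∈w , x~y)

  -- In the exchanged case saturation is the conflict with the child recorded in `Rejected`: a
  -- member free of conflict with itself and the child must lie inside `S`, and being compatible
  -- with `J` it is kept.
  child-maximal : ∀ {P J S T} → Maximal P S → Child P J S T → Maximal (J ∷ P) T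
  child-maximal m (unchanged clash) .independent = independent m
  child-maximal m (unchanged clash) .covered x∈S = there (covered m x∈S)
  child-maximal m (unchanged clash) .saturated (here refl) ¬JJ ¬JS =
    contradiction clash [ ¬JJ , ¬JS ∘ #-sym ]′
  child-maximal m (unchanged clash) .saturated (there u∈P) ¬uu ¬uS = saturated m u∈P ¬uu ¬uS
  child-maximal m (exchanged (¬JJ , _)) .independent = exchange-independent (independent m) ¬JJ
  child-maximal {P} {J} {S} m (exchanged _) .covered x∈ with ∈-exchange⁻ P S J x∈
  ... | inj₁ x∈J = here (J⊆exchange , x∈J)
  ... | inj₂ x∈P =
    let u , u∈P , k , x∈u = find x∈P in there (lose u∈P (kept⊆exchange u∈P k , x∈u))
  child-maximal m (exchanged _) .saturated (here refl) _ _ = J⊆exchange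
  child-maximal m (exchanged (_ , rej)) .saturated {u} (there u∈P) ¬uu ¬uN
    with proj₂ (allTails-∈ rej u∈P)
  ... | inj₁ u⊆S            = kept⊆exchange u∈P (u⊆S , ¬uN ∘ #-mono id J⊆exchange)
  ... | inj₂ (inj₁ uu)       = contradiction uu ¬uu
  ... | inj₂ (inj₂ (uN , _)) = contradiction uN ¬uN

  -- A maximal T containing J determines the sets that a canonical parent
  -- keeps: they are the members of P inside T.
  canonical-⊆ : ∀ {P S S′ J} → Maximal P S → Maximal P S′ → Canonical P S J → Canonical P S′ J →
                exchange P S J ≡ exchange P S′ J → S ⊆ S′
  canonical-⊆ {P} {S} {S′} {J} m m′ c@(¬JJ , rej) c′@(_ , rej′) eq x∈S =
    let u , u∈P , u⊆S , x∈u = find (covered m x∈S)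
    in proj₁ (agree P rej rej′ id u∈P) u⊆S x∈u
    where
    -- A member inside the child but outside the parent would be rejected, hence conflict with
    -- itself or with the child, which is independent.
    inside : ∀ {S₀} → Maximal P S₀ → Canonical P S₀ J → ∀ {w} → w List.∈ P → w ⊆ exchange P S₀ J → w ⊆ S₀
    inside m₀ (_ , rej₀) w∈P w⊆T with proj₂ (allTails-∈ rej₀ w∈P)
    ... | inj₁ w⊆S             = w⊆S
    ... | inj₂ (inj₁ ww)       = contradiction (#-mono w⊆T w⊆T ww) (exchange-independent (independent m₀) ¬JJ)
    ... | inj₂ (inj₂ (wN , _)) = contradiction (#-mono w⊆T id wN) (exchange-independent (independent m₀) ¬JJ)
    step : ∀ {S₁ S₂} → Maximal P S₁ → Canonical P S₁ J → exchange P S₁ J ≡ exchange P S₂ J →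
           ∀ {u us} → (∀ {w} → w List.∈ us → w ⊆ S₂ → w ⊆ S₁) → Rejected P S₂ J u us → u ⊆ S₁ → u ⊆ S₂
    step _  _  _  _   (inj₁ u⊆S₂) _ = u⊆S₂
    step m₁ _  _  _   (inj₂ (inj₁ uu)) u⊆S₁ = contradiction (#-mono u⊆S₁ u⊆S₁ uu) (independent m₁)
    -- A set kept by the other parent lies inside the common child, hence inside `S₁`, where nothing
    -- can conflict with `u`.
    step m₁ c₁ e  _   (inj₂ (inj₂ (_ , inj₁ kept))) u⊆S₁ =
      let w , w∈P , k , wu = find kept
          w⊆T = subst (w ⊆_) (sym e) (kept⊆exchange w∈P k)
      in contradiction (#-mono (inside m₁ c₁ w∈P w⊆T) u⊆S₁ wu) (independent m₁)
    step m₁ _  _  rec (inj₂ (inj₂ (_ , inj₂ earlier))) u⊆S₁ =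
      let w , w∈us , w⊆S₂ , wu = find earlier
      in contradiction (#-mono (rec w∈us w⊆S₂) u⊆S₁ wu) (independent m₁)
    -- Induction from the end of the list: whether `u` is accepted depends on the kept sets and on
    -- the sets accepted before it, and there both parents agree.
    agree : ∀ us → AllTails (Rejected P S J) us → AllTails (Rejected P S′ J) us →
            (∀ {u} → u List.∈ us → u List.∈ P) →
            ∀ {u} → u List.∈ us → (u ⊆ S → u ⊆ S′) × (u ⊆ S′ → u ⊆ S)
    agree (u ∷ us) (_ ∷ qs) (_ ∷ qs′) us⊆ (there u∈) = agree us qs qs′ (us⊆ ∘ there) u∈
    agree (u ∷ us) (q ∷ qs) (q′ ∷ qs′) us⊆ (here refl) =
        step m c eq (λ w∈ → proj₂ (rec w∈)) q′
      , step m′ c′ (sym eq) (λ w∈ → proj₁ (rec w∈)) q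
      where
      rec : ∀ {w} → w List.∈ us → (w ⊆ S → w ⊆ S′) × (w ⊆ S′ → w ⊆ S)
      rec = agree us qs qs′ (us⊆ ∘ there)

  -- An exchanged child contains `J`, whereas an independent set that clashes with `J` cannot.
  unchanged≢exchanged : ∀ {P J S S′} → ¬ S # S → Clash S J → S ≢ exchange P S′ J
  unchanged≢exchanged {P} {J} {S} {S′} ¬SS clash eq =
    [ (λ JJ → ¬SS (#-mono J⊆S J⊆S JJ)) , (λ SJ → ¬SS (#-mono id J⊆S SJ)) ]′ clash
    where
    J⊆S : J ⊆ S
    J⊆S x∈J = subst (_ ∈_) (sym eq) (J⊆exchange x∈J)

  parent-unique : ∀ {P J S S′ T} → Maximal P S → Maximal P S′ →
                  Child P J S T → Child P J S′ T → S ≡ S′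
  parent-unique {P} {J} {S} {S′} {T} m m′ ch ch′ = helper ch ch′ refl
    where
    -- Two indices joined by an equation: unification cannot decompose an equation between two
    -- values of the abstract `exchange`.
    helper : ∀ {T T′} → Child P J S T → Child P J S′ T′ → T ≡ T′ → S ≡ S′
    helper (unchanged _)  (unchanged _)  eq = eq
    helper (unchanged cl) (exchanged _)  eq = contradiction eq (unchanged≢exchanged {P} (independent m) cl)
    helper (exchanged _)  (unchanged cl) eq = contradiction (sym eq) (unchanged≢exchanged {P} (independent m′) cl)
    helper (exchanged c)  (exchanged c′) eq =
      ⊆-antisym (canonical-⊆ m m′ c c′ eq) (canonical-⊆ m′ m c′ c (sym eq))

  -- The tail is completed before the head is considered, so the list `us` in `Rejected` consists of
  -- exactly the sets decided before `u`.
  greedy : Subset n → List (Subset n) → Subset n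
  greedy K []       = K
  greedy K (u ∷ us) with u #? u | u #? greedy K us
  ... | no _ | no _ = u ∪ greedy K us
  ... | _    | _    = greedy K us

  greedy-tail⊆ : ∀ K u us → greedy K us ⊆ greedy K (u ∷ us)
  greedy-tail⊆ K u us with u #? u | u #? greedy K us
  ... | no _  | no _  = x∈p∪q⁺ ∘ inj₂
  ... | no _  | yes _ = id
  ... | yes _ | _     = id

  K⊆greedy : ∀ K us → K ⊆ greedy K us
  K⊆greedy K []       = id
  K⊆greedy K (u ∷ us) x∈ = greedy-tail⊆ K u us (K⊆greedy K us x∈)

  greedy-independent : ∀ {K} us → ¬ K # K → ¬ greedy K us # greedy K us
  greedy-independent {K} []       ¬KK = ¬KK
  greedy-independent {K} (u ∷ us) ¬KK with u #? u | u #? greedy K us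
  ... | no ¬uu | no ¬ug = ∪-independent u _ ¬uu (greedy-independent us ¬KK) ¬ug
  ... | no _   | yes _  = greedy-independent us ¬KK
  ... | yes _  | _      = greedy-independent us ¬KK

  greedy-covered : ∀ {K} us {x} → x ∈ greedy K us → x ∈ K ⊎ Any (λ u → u ⊆ greedy K us × x ∈ u) us
  greedy-covered [] x∈ = inj₁ x∈
  greedy-covered {K} (u ∷ us) {x} x∈ = weaken (split x∈)
    where
    split : x ∈ greedy K (u ∷ us) → (u ⊆ greedy K (u ∷ us) × x ∈ u) ⊎ x ∈ greedy K us
    split x∈′ with u #? u | u #? greedy K us
    ... | no _  | yes _ = inj₂ x∈′
    ... | yes _ | _     = inj₂ x∈′
    ... | no _  | no _ with x∈p∪q⁻ u _ x∈′
    ...   | inj₁ x∈u = inj₁ (x∈p∪q⁺ ∘ inj₁ , x∈u)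
    ...   | inj₂ x∈g = inj₂ x∈g
    weaken : (u ⊆ greedy K (u ∷ us) × x ∈ u) ⊎ x ∈ greedy K us →
             x ∈ K ⊎ Any (λ u′ → u′ ⊆ greedy K (u ∷ us) × x ∈ u′) (u ∷ us)
    weaken (inj₁ found) = inj₂ (here found)
    weaken (inj₂ x∈g) with greedy-covered us x∈g
    ... | inj₁ x∈K = inj₁ x∈K
    ... | inj₂ x∈us =
      let w , w∈us , w⊆ , x∈w = find x∈us in inj₂ (there (lose w∈us (greedy-tail⊆ K u us ∘ w⊆ , x∈w)))

  greedy-rejects : ∀ K u us → u ⊆ greedy K (u ∷ us) ⊎ u # u ⊎ u # greedy K us
  greedy-rejects K u us with u #? u | u #? greedy K us
  ... | no _   | no _   = inj₁ (x∈p∪q⁺ ∘ inj₁)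
  ... | no _   | yes ug = inj₂ (inj₂ ug)
  ... | yes uu | _      = inj₂ (inj₁ uu)

  -- A refused set conflicts with the completion reached at that moment, and completions only grow.
  greedy-saturated : ∀ {K} us {u} → u List.∈ us → ¬ u # u → ¬ u # greedy K us → u ⊆ greedy K us
  greedy-saturated {K} (u ∷ us) (here refl) ¬uu ¬ug with greedy-rejects K u us
  ... | inj₁ u⊆g       = u⊆g
  ... | inj₂ (inj₁ uu) = contradiction uu ¬uu
  ... | inj₂ (inj₂ ug) = contradiction (#-mono id (greedy-tail⊆ K u us) ug) ¬ug
  greedy-saturated {K} (v ∷ us) (there u∈) ¬uu ¬ug =
    greedy-tail⊆ K v us ∘ greedy-saturated us u∈ ¬uu (¬ug ∘ #-mono id (greedy-tail⊆ K v us))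

  -- If `J` is not inside `T`, then `T` is its own parent. Otherwise the members of `P` inside `T`
  -- are completed greedily to `S`. Exchanging `J` back in drops what the completion added: a kept
  -- set is compatible with `K`, which lies inside `S`, and with `J`, hence with all of `T`, and
  -- saturation puts it inside `T`.
  parent : ∀ {P J T} → Maximal (J ∷ P) T → ∃[ S ] (Maximal P S × Child P J S T)
  parent {P} {J} {T} m with J ⊆? T
  ... | no J⊈T = T , mT , unchanged clash
    where
    mT : Maximal P T
    mT .independent = independent m
    mT .covered x∈T with covered m x∈T
    ... | here (J⊆T , _) = ⊥-elim (J⊈T J⊆T)
    ... | there x∈P      = x∈P
    mT .saturated = saturated m ∘ there
    clash : Clash T J
    clash with J #? J | T #? J
    ... | yes JJ | _      = inj₁ JJ
    ... | no _   | yes TJ = inj₂ TJ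
    ... | no ¬JJ | no ¬TJ = ⊥-elim (J⊈T (saturated m (here refl) ¬JJ (¬TJ ∘ #-sym)))
  ... | yes J⊆T = S , mS , subst (Child P J S) N≡T (exchanged (¬TT ∘ #-mono J⊆T J⊆T , go P id id))
    where
    ¬TT = independent m
    K = ⋃ (filter (_⊆? T) P)
    S = greedy K P
    K⁺ : ∀ {u} → u List.∈ P → u ⊆ T → u ⊆ K
    K⁺ u∈P u⊆T x∈u = ∈-⋃-filter⁺ (_⊆? T) (lose u∈P (u⊆T , x∈u))
    K⁻ : ∀ {x} → x ∈ K → Any (λ u → u ⊆ T × x ∈ u) P
    K⁻ = ∈-⋃-filter⁻ (_⊆? T) P
    K⊆T : K ⊆ T
    K⊆T x∈K = let _ , _ , u⊆T , x∈u = find (K⁻ x∈K) in u⊆T x∈u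
    K⊆S : K ⊆ S
    K⊆S = K⊆greedy K P
    T⁻ : ∀ {x} → x ∈ T → x ∈ J ⊎ x ∈ K
    T⁻ x∈T with covered m x∈T
    ... | here (_ , x∈J) = inj₁ x∈J
    ... | there x∈P = let u , u∈P , u⊆T , x∈u = find x∈P in inj₂ (K⁺ u∈P u⊆T x∈u)
    ¬SS : ¬ S # S
    ¬SS = greedy-independent P (¬TT ∘ #-mono K⊆T K⊆T)
    mS : Maximal P S
    mS .independent = ¬SS
    mS .covered x∈S with greedy-covered P x∈S
    ... | inj₂ x∈P = x∈P
    ... | inj₁ x∈K = let u , u∈P , u⊆T , x∈u = find (K⁻ x∈K) in lose u∈P (K⊆S ∘ K⁺ u∈P u⊆T , x∈u)
    mS .saturated = greedy-saturated P
    absorbs : ∀ {u} → u List.∈ P → ¬ u # u → ¬ u # K → ¬ u # J → u ⊆ T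
    absorbs u∈P ¬uu ¬uK ¬uJ = saturated m (there u∈P) ¬uu
      λ (x , y , x∈u , y∈T , x~y) →
        [ (λ y∈J → ¬uJ (x , y , x∈u , y∈J , x~y)) , (λ y∈K → ¬uK (x , y , x∈u , y∈K , x~y)) ]′ (T⁻ y∈T)
    kept-inside : ∀ {u} → u List.∈ P → Kept S J u → u ⊆ T
    kept-inside u∈P (u⊆S , ¬uJ) = absorbs u∈P (¬SS ∘ #-mono u⊆S u⊆S) (¬SS ∘ #-mono u⊆S K⊆S) ¬uJ
    inside-kept : ∀ {u} → u List.∈ P → u ⊆ T → Kept S J u
    inside-kept u∈P u⊆T = K⊆S ∘ K⁺ u∈P u⊆T , ¬TT ∘ #-mono u⊆T J⊆T
    N⊆T : exchange P S J ⊆ T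
    N⊆T x∈N with ∈-exchange⁻ P S J x∈N
    ... | inj₁ x∈J = J⊆T x∈J
    ... | inj₂ x∈P = let u , u∈P , k , x∈u = find x∈P in kept-inside u∈P k x∈u
    N≡T : exchange P S J ≡ T
    N≡T = ⊆-antisym N⊆T λ x∈T → ∈-exchange⁺ P S J ([ inj₁ , (λ x∈K →
      let u , u∈P , u⊆T , x∈u = find (K⁻ x∈K) in inj₂ (lose u∈P (inside-kept u∈P u⊆T , x∈u))) ]′ (T⁻ x∈T))
    outside : ∀ {u} → u List.∈ P → u ⊆ S ⊎ u # u ⊎ u # T
    outside {u} u∈P with u #? u | u #? T
    ... | yes uu | _      = inj₂ (inj₁ uu)
    ... | no _   | yes uT = inj₂ (inj₂ uT)
    ... | no ¬uu | no ¬uT = inj₁ (K⊆S ∘ K⁺ u∈P (saturated m (there u∈P) ¬uu ¬uT))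
    -- `Rejected` asks for two things: saturation of `T`, through `outside`, gives the conflict with
    -- the child; refusal by the greedy completion gives the witness, a kept set or one accepted
    -- earlier.
    rejects : ∀ u us → u List.∈ P → greedy K (u ∷ us) ⊆ S → Rejected P S J u us
    rejects u us u∈P g⊆S with greedy-rejects K u us | outside u∈P
    ... | inj₁ u⊆g       | _                = inj₁ (g⊆S ∘ u⊆g)
    ... | inj₂ _         | inj₁ u⊆S         = inj₁ u⊆S
    ... | inj₂ _         | inj₂ (inj₁ uu)   = inj₂ (inj₁ uu)
    ... | inj₂ (inj₁ uu) | _                = inj₂ (inj₁ uu)
    ... | inj₂ (inj₂ (x , y , x∈u , y∈g , x~y)) | inj₂ (inj₂ uT) =
      inj₂ (inj₂ (subst (u #_) (sym N≡T) uT , source (greedy-covered us y∈g)))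
      where
      source : y ∈ K ⊎ Any (λ w → w ⊆ greedy K us × y ∈ w) us →
               Any (λ w → Kept S J w × w # u) P ⊎ Any (λ w → w ⊆ S × w # u) us
      source (inj₁ y∈K) = inj₁ (let w , w∈P , w⊆T , y∈w = find (K⁻ y∈K) in
        lose w∈P (inside-kept w∈P w⊆T , (y , x , y∈w , x∈u , ~-sym x~y)))
      source (inj₂ y∈us) = inj₂ (let w , w∈us , w⊆g , y∈w = find y∈us in
        lose w∈us (g⊆S ∘ greedy-tail⊆ K u us ∘ w⊆g , (y , x , y∈w , x∈u , ~-sym x~y)))
    go : ∀ us → (∀ {u} → u List.∈ us → u List.∈ P) → greedy K us ⊆ S → AllTails (Rejected P S J) us
    go []       _   _   = []
    go (u ∷ us) us⊆ g⊆S =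
      rejects u us (us⊆ (here refl)) g⊆S ∷ go us (us⊆ ∘ there) (g⊆S ∘ greedy-tail⊆ K u us)

  -- The outcome of the search in the order in which the program emits it, so that the run can be
  -- compared with it by induction on the remaining members.
  leaves : List (Subset n) → Subset n → List (Subset n) → List (Subset n)
  leaves P S []      = S ∷ []
  leaves P S (J ∷ R) =
    (ifᵇ does (canonical? P S J) then leaves (J ∷ P) (exchange P S J) R else []) ++
    (ifᵇ does (clash? S J) then leaves (J ∷ P) S R else [])

  ∈-leaves⁺ : ∀ {P J} R {S S′ T} → Child P J S S′ → T List.∈ leaves (J ∷ P) S′ R → T List.∈ leaves P S (J ∷ R)
  ∈-leaves⁺ {P} {J} R {S} (exchanged c) T∈ with canonical? P S J
  ... | yes _ = ∈-++⁺ˡ T∈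
  ... | no ¬c = contradiction c ¬c
  ∈-leaves⁺ {P} {J} R {S} (unchanged c) T∈ with clash? S J
  ... | yes _ = ∈-++⁺ʳ (ifᵇ does (canonical? P S J) then _ else []) T∈
  ... | no ¬c = contradiction c ¬c

  ∈-leaves⁻ : ∀ P J R S {T} → T List.∈ leaves P S (J ∷ R) →
              ∃[ S′ ] (Child P J S S′ × T List.∈ leaves (J ∷ P) S′ R)
  ∈-leaves⁻ P J R S T∈ with canonical? P S J | clash? S J
  ... | no _  | yes cl = S , unchanged cl , T∈
  ... | yes c | no _ with ∈-++⁻ (leaves (J ∷ P) (exchange P S J) R) T∈
  ...   | inj₁ T∈₁ = _ , exchanged c , T∈₁
  ∈-leaves⁻ P J R S T∈ | yes c | yes cl with ∈-++⁻ (leaves (J ∷ P) (exchange P S J) R) T∈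
  ...   | inj₁ T∈₁ = _ , exchanged c , T∈₁
  ...   | inj₂ T∈₂ = _ , unchanged cl , T∈₂

  leaves-sound : ∀ {P S T} R → Maximal P S → T List.∈ leaves P S R → Maximal (R ʳ++ P) T
  leaves-sound [] m (here refl) = m
  leaves-sound {P} {S} (J ∷ R) m T∈ =
    let _ , ch , T∈′ = ∈-leaves⁻ P J R S T∈ in leaves-sound R (child-maximal m ch) T∈′

  -- The root is found rather than prescribed: each level takes the parent of the node found one
  -- level below. For `P` empty it can only be the empty set.
  leaves-complete : ∀ {P T} R → Maximal (R ʳ++ P) T → ∃[ S ] (Maximal P S × T List.∈ leaves P S R)
  leaves-complete [] m = _ , m , here refl
  leaves-complete (J ∷ R) m =
    let S′ , m′ , T∈ = leaves-complete R m
        S , mS , ch  = parent m′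
    in S , mS , ∈-leaves⁺ R ch T∈

  -- Iterates `parent-unique` from the leaf upwards. It makes the two lists appended by `leaves`
  -- disjoint.
  root-unique : ∀ {P S S′ T} R → Maximal P S → Maximal P S′ →
                T List.∈ leaves P S R → T List.∈ leaves P S′ R → S ≡ S′
  root-unique [] _ _ (here refl) (here refl) = refl
  root-unique {P} {S} {S′} (J ∷ R) m m′ T∈ T∈′
    with ∈-leaves⁻ P J R S T∈ | ∈-leaves⁻ P J R S′ T∈′
  ... | _ , ch , T∈₁ | _ , ch′ , T∈₁′
    with root-unique R (child-maximal m ch) (child-maximal m′ ch′) T∈₁ T∈₁′
  ... | refl = parent-unique m m′ ch ch′

  leaves-unique : ∀ {P S} R → Maximal P S → Unique (leaves P S R)
  leaves-unique [] m = [] ∷ []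
  leaves-unique {P} {S} (J ∷ R) m with canonical? P S J | clash? S J
  ... | no _  | no _   = []
  ... | no _  | yes cl = leaves-unique R (child-maximal m (unchanged cl))
  ... | yes c | no _   = Unique.++⁺ (leaves-unique R (child-maximal m (exchanged c))) [] λ { (_ , ()) }
  ... | yes c | yes cl =
    Unique.++⁺ (leaves-unique R (child-maximal m (exchanged c)))
               (leaves-unique R (child-maximal m (unchanged cl)))
               λ (T∈ , T∈′) → unchanged≢exchanged {P} (independent m) cl
                 (sym (root-unique R (child-maximal m (exchanged c)) (child-maximal m (unchanged cl)) T∈ T∈′))

  -- Processed members are put in front of `P`, so the search ends with the given list reversed.
  leaves-list-maximal : ∀ R → leaves [] ⊥ R Lists Maximal (reverse R)
  leaves-list-maximal R = leaves-unique R maximal-[] , λ T →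
    mk⇔ (leaves-sound R maximal-[]) (λ m → complete (leaves-complete R m))
    where
    complete : ∀ {T} → ∃[ S ] (Maximal [] S × T List.∈ leaves [] S R) → T List.∈ leaves [] ⊥ R
    complete (S , m , T∈) = subst (λ S → _ List.∈ leaves [] S R) (maximal-[]⁻ m) T∈

-- Preferred extensions as maximal unions of irreducible sets

module Preferences (F : AF) where
  open AF F

  _~_ : Rel Arg 0ℓ
  x ~ y = x ⇝ y ⊎ y ⇝ x

  _⇝?_ : Decidable _⇝_
  y ⇝? x = x ∈? lookup attackedBy y

  open MaximalUnions _~_ swap (λ x y → (x ⇝? y) ⊎-dec (y ⇝? x)) public

  conflictFree⇔independent : ∀ S → ConflictFree S ⇔ (¬ S # S)
  conflictFree⇔independent S = mk⇔
    (λ { cf (x , y , x∈S , y∈S , inj₁ x⇝y) → cf y (y∈S , x , x∈S , x⇝y)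
       ; cf (x , y , x∈S , y∈S , inj₂ y⇝x) → cf x (x∈S , y , y∈S , y⇝x) })
    (λ ¬SS x (x∈S , y , y∈S , y⇝x) → ¬SS (y , x , y∈S , x∈S , inj₁ y⇝x))

  selfDefending? : U.Decidable SelfDefending
  selfDefending? S = map′ (λ h {x} → h x) (λ h x → h {x}) (all? λ x → attacker? x →-dec attacked? x)
    where
    attacker? : U.Decidable (S ⁻)
    attacker? x = any? λ y → y ∈? S ×-dec x ⇝? y
    attacked? : U.Decidable (S ⁺)
    attacked? x = any? λ y → y ∈? S ×-dec y ⇝? x

  selfDefending-∪ : ∀ S T → SelfDefending S → SelfDefending T → SelfDefending (S ∪ T)
  selfDefending-∪ S T sdS sdT (y , y∈ , x⇝y) with x∈p∪q⁻ S T y∈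
  ... | inj₁ y∈S = let z , z∈S , z⇝x = sdS (y , y∈S , x⇝y) in z , x∈p∪q⁺ (inj₁ z∈S) , z⇝x
  ... | inj₂ y∈T = let z , z∈T , z⇝x = sdT (y , y∈T , x⇝y) in z , x∈p∪q⁺ (inj₂ z∈T) , z⇝x

  -- A minimal self-defending subset containing x is irreducible.
  irreducible-cover : ∀ {S x} → SelfDefending S → x ∈ S → ∃[ u ] (Irreducible u × u ⊆ S × x ∈ u)
  irreducible-cover {S} {x} sd x∈S = descend S (<-wellFounded (cardinality S)) sd x∈S
    where
    descend : ∀ S → Acc _<_ (cardinality S) → SelfDefending S → x ∈ S → ∃[ u ] (Irreducible u × u ⊆ S × x ∈ u)
    descend S (acc rec) sd x∈S
      with anySubset? (λ T → T ⊂? S ×-dec selfDefending? T ×-dec x ∈? T)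
    ... | yes (T , T⊂S , sdT , x∈T) =
      let u , irr , u⊆T , x∈u = descend T (rec (p⊂q⇒∣p∣<∣q∣ T⊂S)) sdT x∈T
      in u , irr , proj₁ T⊂S ∘ u⊆T , x∈u
    ... | no minimal = S , (sd , (λ { refl → ∉⊥ x∈S }) , split) , id , x∈S
      where
      whole : ∀ T → T ⊆ S → SelfDefending T → x ∈ T → S ≡ T
      whole T T⊆S sdT x∈T with S ⊆? T
      ... | yes S⊆T = ⊆-antisym S⊆T T⊆S
      ... | no S⊈T = ⊥-elim (minimal (T , (T⊆S , strict) , sdT , x∈T))
        where
        strict : ∃[ y ] (y ∈ S × ¬ y ∈ T)
        strict with any? (λ y → y ∈? S ×-dec ¬? (y ∈? T))
        ... | yes p = p
        ... | no ¬p = ⊥-elim (S⊈T λ {y} y∈S → decidable-stable (y ∈? T) λ y∉T → ¬p (y , y∈S , y∉T))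
      split : ∀ S₁ S₂ → SelfDefending S₁ → SelfDefending S₂ → S ≡ S₁ ∪ S₂ → S ≡ S₁ ⊎ S ≡ S₂
      -- One of the two parts contains `x`, and by minimality that part is all of `S`.
      split S₁ S₂ sd₁ sd₂ eq with x∈p∪q⁻ S₁ S₂ (subst (x ∈_) eq x∈S)
      ... | inj₁ x∈S₁ = inj₁ (whole S₁ (λ y∈ → subst (_ ∈_) (sym eq) (x∈p∪q⁺ (inj₁ y∈))) sd₁ x∈S₁)
      ... | inj₂ x∈S₂ = inj₂ (whole S₂ (λ y∈ → subst (_ ∈_) (sym eq) (x∈p∪q⁺ (inj₂ y∈))) sd₂ x∈S₂)

  -- Forwards, each element of an admissible superset `T` lies in an irreducible set inside `T`,
  -- which is compatible with `S` and so absorbed by saturation. Backwards, adding a compatible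
  -- irreducible set to `S` leaves it admissible, so by maximality that set was already inside.
  maximal⇔preferred : ∀ {P} → (∀ u → u List.∈ P ⇔ Irreducible u) → ∀ S → Maximal P S ⇔ Preferred S
  maximal⇔preferred {P} irr S = mk⇔ to from
    where
    open Maximal
    to : Maximal P S → Preferred S
    to m = (Equivalence.from (conflictFree⇔independent S) (independent m) , sd) , max
      where
      sd : SelfDefending S
      sd (y , y∈S , x⇝y) =
        let u , u∈P , u⊆S , y∈u = find (covered m y∈S)
            z , z∈u , z⇝x = proj₁ (Equivalence.to (irr u) u∈P) (y , y∈u , x⇝y)
        in z , u⊆S z∈u , z⇝x
      max : ∀ T → Admissible T → S ⊆ T → S ≡ T
      max T (cfT , sdT) S⊆T = ⊆-antisym S⊆T λ x∈T →
        let u , irr-u , u⊆T , x∈u = irreducible-cover sdT x∈T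
            ¬TT = Equivalence.to (conflictFree⇔independent T) cfT
        in saturated m (Equivalence.from (irr u) irr-u) (¬TT ∘ #-mono u⊆T u⊆T) (¬TT ∘ #-mono u⊆T S⊆T) x∈u
    from : Preferred S → Maximal P S
    from ((cf , sd) , max) = record
      { independent = ¬SS
      ; covered = λ x∈S → let u , irr-u , u⊆S , x∈u = irreducible-cover sd x∈S
                          in lose (Equivalence.from (irr u) irr-u) (u⊆S , x∈u)
      ; saturated = λ {u} u∈P ¬uu ¬uS x∈u →
          subst (_ ∈_) (sym (max (S ∪ u)
            ( Equivalence.from (conflictFree⇔independent (S ∪ u)) (∪-independent S u ¬SS ¬uu (¬uS ∘ #-sym))
            , selfDefending-∪ S u sd (proj₁ (Equivalence.to (irr u) u∈P)))
            (x∈p∪q⁺ ∘ inj₁)))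
            (x∈p∪q⁺ (inj₂ x∈u))
      }
      where
      ¬SS : ¬ S # S
      ¬SS = Equivalence.to (conflictFree⇔independent S) cf

  leaves-list-preferred : ∀ {irr} → irr Lists Irreducible → leaves [] ⊥ irr Lists Preferred
  leaves-list-preferred {irr} (_ , irr⇔) =
    let unique , ∈⇔ = leaves-list-maximal irr
    in unique , λ S → mk⇔ (Equivalence.to (pref S) ∘ Equivalence.to (∈⇔ S))
                          (Equivalence.from (∈⇔ S) ∘ Equivalence.from (pref S))
    where
    pref : ∀ S → Maximal (reverse irr) S ⇔ Preferred S
    pref = maximal⇔preferred λ u → mk⇔ (Equivalence.to (irr⇔ u) ∘ reverse⁻) (reverse⁺ ∘ Equivalence.from (irr⇔ u))

-- Compiling bounded formulas

-- Delay and space bounds are demanded of all runs, but only one run is constructed; determinism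
-- carries its properties over to the others.
⇓-deterministic : ∀ {k} {c : Cmd k} {σ σ₁ σ₂ τ₁ τ₂} →
                  ⟨ c , σ ⟩⇓⟨ τ₁ , σ₁ ⟩ → ⟨ c , σ ⟩⇓⟨ τ₂ , σ₂ ⟩ → τ₁ ≡ τ₂ × σ₁ ≡ σ₂
⇓-deterministic ⇓-skip ⇓-skip = refl , refl
⇓-deterministic ⇓-assign ⇓-assign = refl , refl
⇓-deterministic ⇓-output ⇓-output = refl , refl
⇓-deterministic (⇓-seq c₁ d₁) (⇓-seq c₂ d₂) with ⇓-deterministic c₁ c₂
... | refl , refl with ⇓-deterministic d₁ d₂
...   | refl , refl = refl , refl
⇓-deterministic (⇓-then _ c₁) (⇓-then _ c₂) with ⇓-deterministic c₁ c₂
... | refl , refl = refl , refl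
⇓-deterministic (⇓-then e≢ _) (⇓-else e≡ _) = contradiction e≡ e≢
⇓-deterministic (⇓-else e≡ _) (⇓-then e≢ _) = contradiction e≡ e≢
⇓-deterministic (⇓-else _ c₁) (⇓-else _ c₂) with ⇓-deterministic c₁ c₂
... | refl , refl = refl , refl
⇓-deterministic (⇓-exit _) (⇓-exit _) = refl , refl
⇓-deterministic (⇓-exit e≡) (⇓-loop e≢ _ _) = contradiction e≡ e≢
⇓-deterministic (⇓-loop e≢ _ _) (⇓-exit e≡) = contradiction e≡ e≢
⇓-deterministic (⇓-loop _ c₁ d₁) (⇓-loop _ c₂ d₂) with ⇓-deterministic c₁ c₂
... | refl , refl with ⇓-deterministic d₁ d₂
...   | refl , refl = refl , refl

infixr 6 _⊹_

-- Addition with an accumulator: `suc d ⊹ k` reduces to `d ⊹ suc k`, so the body of a quantifier is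
-- a command over the very same store type as the quantifier itself.
_⊹_ : ℕ → ℕ → ℕ
zero  ⊹ k = k
suc d ⊹ k = d ⊹ suc k

fill : ∀ {d k} → Vec 𝔻 d → Vec 𝔻 k → Vec 𝔻 (d ⊹ k)
fill []      env = env
fill (v ∷ s) env = fill s (v ∷ env)

place : ∀ d {k} → Fin k → Fin (d ⊹ k)
place zero    i = i
place (suc d) i = place d (suc i)

lookup-fill : ∀ {d k} (s : Vec 𝔻 d) (env : Vec 𝔻 k) i → lookup (fill s env) (place d i) ≡ lookup env i
lookup-fill []      env i = refl
lookup-fill (v ∷ s) env i = lookup-fill s (v ∷ env) (suc i)

update-fill : ∀ {d k} (s : Vec 𝔻 d) (env : Vec 𝔻 k) i v →
              fill s env [ place d i ]≔ v ≡ fill s (env [ i ]≔ v)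
update-fill []      env i v = refl
update-fill (u ∷ s) env i v = update-fill s (u ∷ env) (suc i) v

All-fill : ∀ {P : 𝔻 → Set} {d k} {s : Vec 𝔻 d} {env : Vec 𝔻 k} → All P s → All P env → All P (fill s env)
All-fill []       pe = pe
All-fill (p ∷ ps) pe = All-fill ps (p ∷ pe)

-- A store consists of a result register, scratch variables for the bound
-- variables of formulas, and the variables in scope.  Binding moves the
-- outermost scratch variables into scope without moving them in the store.
state : ∀ {d k} → 𝔻 → Vec 𝔻 d → Vec 𝔻 k → Store (suc (d ⊹ k))
state r s env = r ∷ fill s env

lift : ∀ d {k} → Expr k → Expr (suc (d ⊹ k))
lift d (var i)     = var (suc (place d i))
lift d `nil        = `nil
lift d (`cons e f) = `cons (lift d e) (lift d f)
lift d (`hd e)     = `hd (lift d e)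
lift d (`tl e)     = `tl (lift d e)

⟦lift⟧ : ∀ {d k} (e : Expr k) r (s : Vec 𝔻 d) env → ⟦ lift d e ⟧ (state r s env) ≡ ⟦ e ⟧ env
⟦lift⟧ (var i)     r s env = lookup-fill s env i
⟦lift⟧ `nil        r s env = refl
⟦lift⟧ (`cons e f) r s env = cong₂ cons (⟦lift⟧ e r s env) (⟦lift⟧ f r s env)
⟦lift⟧ (`hd e)     r s env = cong hd (⟦lift⟧ e r s env)
⟦lift⟧ (`tl e)     r s env = cong tl (⟦lift⟧ e r s env)

set : ∀ d {k} → Fin k → Expr k → Cmd (suc (d ⊹ k))
set d i e = suc (place d i) ≔ lift d e

-- Expressions without `cons`: their values are never larger than the variable they start from, so
-- evaluating formulas respects any size bound on the store.
data Path (k : ℕ) : Set where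
  var     : Fin k → Path k
  `hd `tl : Path k → Path k

⌞_⌟ : ∀ {k} → Path k → Expr k
⌞ var i ⌟ = var i
⌞ `hd p ⌟ = `hd ⌞ p ⌟
⌞ `tl p ⌟ = `tl ⌞ p ⌟

wk : ∀ {k} → Path k → Path (2 + k)
wk (var i) = var (suc (suc i))
wk (`hd p) = `hd (wk p)
wk (`tl p) = `tl (wk p)

⟦wk⟧ : ∀ {k} (p : Path k) {a b env} → ⟦ ⌞ wk p ⌟ ⟧ (b ∷ a ∷ env) ≡ ⟦ ⌞ p ⌟ ⟧ env
⟦wk⟧ (var i) = refl
⟦wk⟧ (`hd p) = cong hd (⟦wk⟧ p)
⟦wk⟧ (`tl p) = cong tl (⟦wk⟧ p)

-- k variables are in scope and d scratch variables are available.
data Formula : ℕ → ℕ → Set where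
  nonnil : ∀ {k d} → Path k → Formula k d
  not    : ∀ {k d} → Formula k d → Formula k d
  _and_  : ∀ {k d} → Formula k d → Formula k d → Formula k d
  _or_   : ∀ {k d} → Formula k d → Formula k d → Formula k d
  some   : ∀ {k d} → Path k → Path k → Formula (2 + k) d → Formula k (2 + d)

infixr 6 _and_
infixr 5 _or_

-- Two lists are traversed in parallel; Q speaks about what remains of them.
Some : (𝔻 → 𝔻 → Set) → 𝔻 → 𝔻 → Set
Some Q nil          e = Empty.⊥
Some Q d@(cons _ t) e = Q d e ⊎ Some Q t (tl e)

some? : ∀ {Q} → (∀ d e → Dec (Q d e)) → ∀ d e → Dec (Some Q d e)
some? Q? nil          e = no id
some? Q? d@(cons _ t) e = Q? d e ⊎-dec some? Q? t (tl e)

Holds : ∀ {k d} → Formula k d → Vec 𝔻 k → Set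
Holds (nonnil p)   env = ⟦ ⌞ p ⌟ ⟧ env ≢ nil
Holds (not φ)      env = ¬ Holds φ env
Holds (φ and ψ)    env = Holds φ env × Holds ψ env
Holds (φ or ψ)     env = Holds φ env ⊎ Holds ψ env
Holds (some p q φ) env = Some (λ d e → Holds φ (e ∷ d ∷ env)) (⟦ ⌞ p ⌟ ⟧ env) (⟦ ⌞ q ⌟ ⟧ env)

nil? : ∀ d → Dec (d ≡ nil)
nil? nil        = yes refl
nil? (cons _ _) = no λ ()

holds? : ∀ {k d} (φ : Formula k d) env → Dec (Holds φ env)
holds? (nonnil p)   env = ¬? (nil? _)
holds? (not φ)      env = ¬? (holds? φ env)
holds? (φ and ψ)    env = holds? φ env ×-dec holds? ψ env
holds? (φ or ψ)     env = holds? φ env ⊎-dec holds? ψ env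
holds? (some p q φ) env = some? (λ d e → holds? φ (e ∷ d ∷ env)) _ _

`true : ∀ {k} → Expr k
`true = `cons `nil `nil

-- For `some`, the register starts as `nil`, the verdict on an empty list. A success empties the
-- traversed list, which ends the loop with the register still different from `nil`.
compile : ∀ {k d} → Formula k d → Cmd (suc (d ⊹ k))
compile {d = d} (nonnil p) = zero ≔ lift d ⌞ p ⌟
compile (not φ)   = compile φ ⨾ (if var zero then zero ≔ `nil else (zero ≔ `true))
compile (φ and ψ) = compile φ ⨾ (if var zero then compile ψ else skip)
compile (φ or ψ)  = compile φ ⨾ (if var zero then skip else compile ψ)
compile (some {d = d} p q φ) =
  set d (suc zero) ⌞ wk p ⌟ ⨾ set d zero ⌞ wk q ⌟ ⨾ zero ≔ `nil ⨾
  while lift d (var (suc zero)) loop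
    (compile φ ⨾
     (if var zero
      then set d (suc zero) `nil
      else (set d (suc zero) (`tl (var (suc zero))) ⨾ set d zero (`tl (var zero)))))

setTime : ∀ d {k} → Expr k → ℕ
setTime d e = suc (evalTime (lift d e))

-- An upper bound for stores whose trees have size at most `B`. A turn of the loop for `some` costs
-- 2 for its test, then the body, then 8: 2 to inspect the register and 3 for each of the two `tl`
-- assignments. A list has no more entries than its size, hence at most `B` turns. Negation adds 2
-- for the test and at most 4 for writing the answer.
time : ∀ {k d} → Formula k d → ℕ → ℕ
time {d = d} (nonnil p) B = setTime d ⌞ p ⌟
time (not φ)   B = time φ B + 6
time (φ and ψ) B = time φ B + (2 + (1 + time ψ B))
time (φ or ψ)  B = time φ B + (2 + (1 + time ψ B))
time (some {d = d} p q φ) B =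
  setTime d ⌞ wk p ⌟ + (setTime d ⌞ wk q ⌟ + (2 + (B * (2 + (time φ B + 8)) + 2)))

-- No constructor admits `emit`. The time index is an upper bound with the slack built in, so
-- branches of unequal cost can share one bound.
data Silent (m : ℕ) : ℕ → Trace → Set where
  []   : ∀ {t} → Silent m t []
  step : ∀ {t t′ a s τ} → s ≤ m → a + t ≤ t′ → Silent m t τ → Silent m t′ (work a s ∷ τ)

silent-≤ : ∀ {m t t′ τ} → t ≤ t′ → Silent m t τ → Silent m t′ τ
silent-≤ t≤t′ []             = []
silent-≤ t≤t′ (step s≤ a≤ q) = step s≤ (≤-trans a≤ t≤t′) q

silent-++ : ∀ {m t t′ τ τ′} → Silent m t τ → Silent m t′ τ′ → Silent m (t + t′) (τ ++ τ′)
silent-++ {t = t} []             q′ = silent-≤ (m≤n+m _ t) q′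
silent-++ {t′ = t′} (step {t} {a = a} s≤ a≤ q) q′ =
  step s≤ (≤-trans (≤-reflexive (sym (+-assoc a t t′))) (+-monoˡ-≤ t′ a≤)) (silent-++ q q′)

∣hd∣≤ : ∀ d → ∣ hd d ∣ ≤ ∣ d ∣
∣hd∣≤ nil        = ≤-refl
∣hd∣≤ (cons d e) = m≤n⇒m≤1+n (m≤m+n ∣ d ∣ ∣ e ∣)

∣tl∣≤ : ∀ d → ∣ tl d ∣ ≤ ∣ d ∣
∣tl∣≤ nil        = ≤-refl
∣tl∣≤ (cons d e) = m≤n⇒m≤1+n (m≤n+m ∣ e ∣ ∣ d ∣)

data Verdict (r : 𝔻) (X : Set) : Set where
  holds : r ≢ nil → X → Verdict r X
  fails : r ≡ nil → ¬ X → Verdict r X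

-- Time and space of compiled formulas in stores of bounded trees

module Bounded (B : ℕ) (3≤B : 3 ≤ B) where

  Small : 𝔻 → Set
  Small d = ∣ d ∣ ≤ B

  small-nil : Small nil
  small-nil = ≤-trans (s≤s z≤n) 3≤B

  small-left : ∀ d e → Small (cons d e) → Small d
  small-left d e small = ≤-trans (m≤m+n _ _) (≤-trans (n≤1+n _) small)

  small-right : ∀ d e → Small (cons d e) → Small e
  small-right d e small = ≤-trans (m≤n+m _ (∣ d ∣)) (≤-trans (n≤1+n _) small)

  -- The last `B` is for the value that `evaluating` counts on top of the `V` variables.
  spaceBound : ℕ → ℕ
  spaceBound V = V * B + B

  storeSize-≤ : ∀ {V} {σ : Store V} → All Small σ → storeSize σ ≤ V * B
  storeSize-≤ []       = z≤n
  storeSize-≤ (p ∷ ps) = +-mono-≤ p (storeSize-≤ ps)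

  Runs : ∀ {V} → Cmd V → Store V → Store V → ℕ → Set
  Runs {V} c σ σ′ t = ∃[ τ ] (⟨ c , σ ⟩⇓⟨ τ , σ′ ⟩ × Silent (spaceBound V) t τ)

  module _ {V : ℕ} where

    runs-≤ : ∀ {c} {σ σ′ : Store V} {t t′} → t ≤ t′ → Runs c σ σ′ t → Runs c σ σ′ t′
    runs-≤ t≤t′ (τ , run , q) = τ , run , silent-≤ t≤t′ q

    evaluated : ∀ {e} {σ : Store V} {t τ} → All Small σ → Small (⟦ e ⟧ σ) → Silent (spaceBound V) t τ →
                Silent (spaceBound V) (suc (evalTime e) + t) (evaluating e σ ∷ τ)
    evaluated fits small = step (+-mono-≤ (storeSize-≤ fits) small) ≤-refl

    runs-skip : ∀ {σ : Store V} → All Small σ → Runs skip σ σ 1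
    runs-skip fits = _ , ⇓-skip , step (≤-trans (storeSize-≤ fits) (m≤m+n _ B)) ≤-refl ([] {t = 0})

    runs-assign : ∀ {x e} {σ : Store V} {v} → All Small σ → ⟦ e ⟧ σ ≡ v → Small v →
                  Runs (x ≔ e) σ (σ [ x ]≔ v) (suc (evalTime e))
    runs-assign {e = e} {σ} fits refl small = _ , ⇓-assign ,
      silent-≤ (≤-reflexive (+-identityʳ _)) (evaluated {e = e} {σ} {0} fits small [])

    infixr 5 _▷_

    _▷_ : ∀ {c d} {σ σ′ σ″ : Store V} {t t′} → Runs c σ σ′ t → Runs d σ′ σ″ t′ → Runs (c ⨾ d) σ σ″ (t + t′)
    (_ , run , q) ▷ (_ , run′ , q′) = _ , ⇓-seq run run′ , silent-++ q q′

    runs-then : ∀ {e c d} {σ σ′ : Store V} {t} → All Small σ → Small (⟦ e ⟧ σ) → ⟦ e ⟧ σ ≢ nil →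
                Runs c σ σ′ t → Runs (if e then c else d) σ σ′ (suc (evalTime e) + t)
    runs-then {e} fits small e≢ (_ , run , q) = _ , ⇓-then e≢ run , evaluated {e} fits small q

    runs-else : ∀ {e c d} {σ σ′ : Store V} {t} → All Small σ → ⟦ e ⟧ σ ≡ nil →
                Runs d σ σ′ t → Runs (if e then c else d) σ σ′ (suc (evalTime e) + t)
    runs-else {e} fits e≡ (_ , run , q) =
      _ , ⇓-else e≡ run , evaluated {e} fits (subst Small (sym e≡) small-nil) q

    runs-exit : ∀ {e c} {σ : Store V} → All Small σ → ⟦ e ⟧ σ ≡ nil →
                Runs (while e loop c) σ σ (suc (evalTime e))
    runs-exit {e} {σ = σ} fits e≡ = _ , ⇓-exit e≡ ,
      silent-≤ (≤-reflexive (+-identityʳ _))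
        (evaluated {e} {σ} {0} fits (subst Small (sym e≡) small-nil) [])

    runs-loop : ∀ {e c} {σ σ′ σ″ : Store V} {t t′} → All Small σ → Small (⟦ e ⟧ σ) → ⟦ e ⟧ σ ≢ nil →
                Runs c σ σ′ t → Runs (while e loop c) σ′ σ″ t′ →
                Runs (while e loop c) σ σ″ (suc (evalTime e) + (t + t′))
    runs-loop {e} fits small e≢ (_ , run , q) (_ , run′ , q′) =
      _ , ⇓-loop e≢ run run′ , evaluated {e} fits small (silent-++ q q′)

  small-path : ∀ {k} (p : Path k) {env} → All Small env → Small (⟦ ⌞ p ⌟ ⟧ env)
  small-path (var i) fits = lookup⁺ fits i
  small-path (`hd p) fits = ≤-trans (∣hd∣≤ _) (small-path p fits)
  small-path (`tl p) fits = ≤-trans (∣tl∣≤ _) (small-path p fits)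

  fits-state : ∀ {d k r} {s : Vec 𝔻 d} {env : Vec 𝔻 k} → Small r → All Small s → All Small env →
               All Small (state r s env)
  fits-state r s env = r ∷ All-fill s env

  runs-set : ∀ {d k r} {s : Vec 𝔻 d} {env : Vec 𝔻 k} i e {v} →
             Small r → All Small s → All Small env →
             ⟦ e ⟧ env ≡ v → Small v →
             Runs (set d i e) (state r s env) (state r s (env [ i ]≔ v)) (setTime d e)
  runs-set {d} {r = r} {s} {env} i e {v} small-r small-s small-env eq small =
    subst (λ σ → Runs (set d i e) (state r s env) (r ∷ σ) (setTime d e)) (update-fill s env i v)
      (runs-assign {e = lift d e} (fits-state small-r small-s small-env) (trans (⟦lift⟧ e r s env) eq) small)

  -- Register and scratch variables may come back with any small contents, but the variables in
  -- scope are restored to what they were; this is what lets decisions be composed.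
  Decides : ∀ {k d} → Cmd (suc (d ⊹ k)) → (Vec 𝔻 k → Set) → ℕ → Set
  Decides {k} {d} c X t = ∀ {r} {s : Vec 𝔻 d} {env : Vec 𝔻 k} → Small r → All Small s → All Small env →
    ∃[ r′ ] Σ[ s′ ∈ Vec 𝔻 d ] (Small r′ × All Small s′ × Verdict r′ (X env) × Runs c (state r s env) (state r′ s′ env) t)

  -- Induction on the traversed tree `a`: every unsuccessful turn replaces it by its tail, so its
  -- size bounds the number of turns.
  search-loop : ∀ {k d} (c : Cmd (suc (d ⊹ (2 + k)))) {X t} → Decides {d = d} c X t →
    let loop = while lift d (var (suc zero)) loop
                 (c ⨾ (if var zero
                       then set d (suc zero) `nil
                       else (set d (suc zero) (`tl (var (suc zero))) ⨾ set d zero (`tl (var zero)))))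
    in ∀ a b {s : Vec 𝔻 d} {env : Vec 𝔻 k} → Small a → Small b → All Small s → All Small env →
       ∃[ r′ ] Σ[ s′ ∈ Vec 𝔻 d ] ∃[ a′ ] ∃[ b′ ]
         (Small r′ × All Small s′ × Small a′ × Small b′ ×
          Verdict r′ (Some (λ a b → X (b ∷ a ∷ env)) a b) ×
          Runs loop (state nil s (b ∷ a ∷ env)) (state r′ s′ (b′ ∷ a′ ∷ env)) (∣ a ∣ * (2 + (t + 8)) + 2))
  search-loop {d = d} c {t = t} decides nil b {s} {env} small-a small-b small-s small-env =
    nil , s , nil , b , small-nil , small-s , small-nil , small-b , fails refl id ,
    runs-≤ (m≤n+m 2 (∣ nil ∣ * (2 + (t + 8))))
      (runs-exit (fits-state small-nil small-s (small-b ∷ small-nil ∷ small-env)) (⟦lift⟧ (var (suc zero)) nil s _))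
  search-loop {d = d} c {X} {t} decides a@(cons h a′) b {s} {env} small-a small-b small-s small-env
    with decides small-nil small-s (small-b ∷ small-a ∷ small-env)
  ... | r₁ , s₁ , small-r₁ , small-s₁ , holds r₁≢nil x , run =
    r₁ , s₁ , nil , b , small-r₁ , small-s₁ , small-nil , small-b , holds r₁≢nil (inj₁ x) ,
    runs-≤ bound
      (runs-loop {e = lift d (var (suc zero))} (fits-state small-nil small-s fits)
        (subst Small (sym (⟦lift⟧ (var (suc zero)) nil s _)) small-a)
        (λ e → contradiction (trans (sym (⟦lift⟧ (var (suc zero)) nil s _)) e) λ ())
        (run ▷ runs-≤ (m≤m+n 4 4)
          (runs-then fits₁ small-r₁ r₁≢nil (runs-set (suc zero) `nil small-r₁ small-s₁ fits refl small-nil)))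
        (runs-exit (fits-state small-r₁ small-s₁ (small-b ∷ small-nil ∷ small-env)) (⟦lift⟧ (var (suc zero)) r₁ s₁ _)))
    where
    fits : All Small (b ∷ a ∷ env)
    fits = small-b ∷ small-a ∷ small-env
    fits₁ : All Small (state r₁ s₁ (b ∷ a ∷ env))
    fits₁ = fits-state small-r₁ small-s₁ fits
    bound : 2 + (t + 8 + 2) ≤ ∣ a ∣ * (2 + (t + 8)) + 2
    bound = +-monoˡ-≤ 2 (m≤m+n (2 + (t + 8)) _)
  ... | .nil , s₁ , small-r₁ , small-s₁ , fails refl ¬x , run
    with search-loop c {X} decides a′ (tl b) (≤-trans (∣tl∣≤ a) small-a) (≤-trans (∣tl∣≤ b) small-b) small-s₁ small-env
  ... | r₂ , s₂ , a₂ , b₂ , small-r₂ , small-s₂ , small-a₂ , small-b₂ , verdict , run₂ =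
    r₂ , s₂ , a₂ , b₂ , small-r₂ , small-s₂ , small-a₂ , small-b₂ , continue verdict ,
    runs-≤ bound
      (runs-loop {e = lift d (var (suc zero))} (fits-state small-nil small-s fits)
        (subst Small (sym (⟦lift⟧ (var (suc zero)) nil s _)) small-a)
        (λ e → contradiction (trans (sym (⟦lift⟧ (var (suc zero)) nil s _)) e) λ ())
        (run ▷ runs-else (fits-state small-nil small-s₁ fits) refl
          (runs-set (suc zero) (`tl (var (suc zero))) small-nil small-s₁ fits refl small-a′ ▷
           runs-set zero (`tl (var zero)) small-nil small-s₁ (small-b ∷ small-a′ ∷ small-env) refl
             (≤-trans (∣tl∣≤ b) small-b)))
        run₂)
    where
    small-a′ : Small a′
    small-a′ = ≤-trans (∣tl∣≤ a) small-a
    fits : All Small (b ∷ a ∷ env)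
    fits = small-b ∷ small-a ∷ small-env
    continue : ∀ {r} → Verdict r (Some (λ a b → X (b ∷ a ∷ env)) a′ (tl b)) →
               Verdict r (Some (λ a b → X (b ∷ a ∷ env)) a b)
    continue (holds r≢ x) = holds r≢ (inj₂ x)
    continue (fails r≡ ¬y) = fails r≡ λ { (inj₁ x) → ¬x x ; (inj₂ y) → ¬y y }
    bound : 2 + (t + 8 + (∣ a′ ∣ * (2 + (t + 8)) + 2)) ≤ ∣ a ∣ * (2 + (t + 8)) + 2
    bound = begin
      2 + (t + 8 + (∣ a′ ∣ * C + 2))      ≡⟨ cong (2 +_) (sym (+-assoc (t + 8) (∣ a′ ∣ * C) 2)) ⟩
      C + ∣ a′ ∣ * C + 2                  ≤⟨ +-monoˡ-≤ 2 (+-monoʳ-≤ C (*-monoˡ-≤ C (m≤n+m ∣ a′ ∣ ∣ h ∣))) ⟩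
      C + (∣ h ∣ + ∣ a′ ∣) * C + 2        ∎
      where
      open ≤-Reasoning
      C = 2 + (t + 8)

  compile-decides : ∀ {k d} (φ : Formula k d) → Decides {d = d} (compile φ) (Holds φ) (time φ B)
  compile-decides {d = d} (nonnil p) {r} {s} {env} small-r small-s small-env =
    ⟦ ⌞ p ⌟ ⟧ env , s , small-path p small-env , small-s , verdict ,
    runs-assign {e = lift d ⌞ p ⌟} (fits-state small-r small-s small-env) (⟦lift⟧ ⌞ p ⌟ r s env) (small-path p small-env)
    where
    verdict : Verdict (⟦ ⌞ p ⌟ ⟧ env) (⟦ ⌞ p ⌟ ⟧ env ≢ nil)
    verdict with nil? (⟦ ⌞ p ⌟ ⟧ env)
    ... | yes e≡ = fails e≡ λ e≢ → e≢ e≡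
    ... | no e≢  = holds e≢ e≢
  compile-decides (not φ) small-r small-s small-env with compile-decides φ small-r small-s small-env
  ... | r₁ , s₁ , small-r₁ , small-s₁ , holds r₁≢nil x , run =
    nil , s₁ , small-nil , small-s₁ , fails refl (λ ¬x → ¬x x) ,
    run ▷ runs-≤ (m≤m+n 4 2) (runs-then fits₁ small-r₁ r₁≢nil (runs-assign fits₁ refl small-nil))
    where fits₁ = fits-state small-r₁ small-s₁ small-env
  ... | r₁ , s₁ , small-r₁ , small-s₁ , fails r₁≡nil ¬x , run =
    -- The truth value has size 3, which is where the bound `3≤B` comes from.
    cons nil nil , s₁ , 3≤B , small-s₁ , holds (λ ()) ¬x ,
    run ▷ runs-else fits₁ r₁≡nil (runs-assign {e = `true} fits₁ refl 3≤B)
    where fits₁ = fits-state small-r₁ small-s₁ small-env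
  compile-decides (φ and ψ) small-r small-s small-env with compile-decides φ small-r small-s small-env
  ... | r₁ , s₁ , small-r₁ , small-s₁ , fails r₁≡nil ¬x , run =
    r₁ , s₁ , small-r₁ , small-s₁ , fails r₁≡nil (¬x ∘ proj₁) ,
    run ▷ runs-≤ (m≤m+n 3 _) (runs-else fits₁ r₁≡nil (runs-skip fits₁))
    where fits₁ = fits-state small-r₁ small-s₁ small-env
  ... | r₁ , s₁ , small-r₁ , small-s₁ , holds r₁≢nil x , run
    with compile-decides ψ small-r₁ small-s₁ small-env
  ... | r₂ , s₂ , small-r₂ , small-s₂ , verdict , run₂ =
    r₂ , s₂ , small-r₂ , small-s₂ , combine verdict ,
    run ▷ runs-≤ (+-monoʳ-≤ 2 (n≤1+n _)) (runs-then (fits-state small-r₁ small-s₁ small-env) small-r₁ r₁≢nil run₂)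
    where
    combine : ∀ {r X} → Verdict r X → Verdict r (_ × X)
    combine (holds r≢ y) = holds r≢ (x , y)
    combine (fails r≡ ¬y) = fails r≡ (¬y ∘ proj₂)
  compile-decides (φ or ψ) small-r small-s small-env with compile-decides φ small-r small-s small-env
  ... | r₁ , s₁ , small-r₁ , small-s₁ , holds r₁≢nil x , run =
    r₁ , s₁ , small-r₁ , small-s₁ , holds r₁≢nil (inj₁ x) ,
    run ▷ runs-≤ (m≤m+n 3 _) (runs-then fits₁ small-r₁ r₁≢nil (runs-skip fits₁))
    where fits₁ = fits-state small-r₁ small-s₁ small-env
  ... | r₁ , s₁ , small-r₁ , small-s₁ , fails r₁≡nil ¬x , run
    with compile-decides ψ small-r₁ small-s₁ small-env
  ... | r₂ , s₂ , small-r₂ , small-s₂ , verdict , run₂ =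
    r₂ , s₂ , small-r₂ , small-s₂ , combine verdict ,
    run ▷ runs-≤ (+-monoʳ-≤ 2 (n≤1+n _)) (runs-else (fits-state small-r₁ small-s₁ small-env) r₁≡nil run₂)
    where
    combine : ∀ {r X} → Verdict r X → Verdict r (_ ⊎ X)
    combine (holds r≢ y) = holds r≢ (inj₂ y)
    combine (fails r≡ ¬y) = fails r≡ λ { (inj₁ x) → ¬x x ; (inj₂ y) → ¬y y }
  compile-decides (some {d = d} p q φ) {r} {x₀ ∷ y₀ ∷ s} {env} small-r (small-x ∷ small-y ∷ small-s) small-env
    with search-loop (compile φ) {X = Holds φ} (compile-decides φ) (⟦ ⌞ p ⌟ ⟧ env) (⟦ ⌞ q ⌟ ⟧ env)
           (small-path p small-env) (small-path q small-env) small-s small-env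
  ... | r₁ , s₁ , a₁ , b₁ , small-r₁ , small-s₁ , small-a₁ , small-b₁ , verdict , run =
    -- `fill` reverses the scratch variables when moving them into scope, so the first list, bound
    -- as variable 1, is the outermost of the two.
    r₁ , a₁ ∷ b₁ ∷ s₁ , small-r₁ , small-a₁ ∷ small-b₁ ∷ small-s₁ , verdict ,
    runs-set (suc zero) ⌞ wk p ⌟ small-r small-s (small-y ∷ small-x ∷ small-env) (⟦wk⟧ p) small-p ▷
    runs-set zero ⌞ wk q ⌟ small-r small-s (small-y ∷ small-p ∷ small-env) (⟦wk⟧ q) small-q ▷
    runs-assign (fits-state small-r small-s (small-q ∷ small-p ∷ small-env)) refl small-nil ▷
    runs-≤ (+-monoˡ-≤ 2 (*-monoˡ-≤ (2 + (time φ B + 8)) small-p)) run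
    where
    small-p = small-path p small-env
    small-q = small-path q small-env

-- The conditions of the search as formulas

attackF conflictF : ∀ {k d} → Path k → Path k → Path k → Formula k (4 + d)
attackF R A B =
  some A R (nonnil (`hd (var 1F)) and some (`hd (var 0F)) (wk B) (nonnil (`hd (var 1F)) and nonnil (`hd (var 0F))))
conflictF R A B = attackF R A B or attackF R B A

subsetF elemF : ∀ {k d} → Path k → Path k → Formula k (2 + d)
subsetF A B = not (some A B (nonnil (`hd (var 1F)) and not (nonnil (`hd (var 0F)))))
-- The index of an argument is encoded by any list longer by one.
elemF z A   = some z A (not (nonnil (`tl (var 1F))) and nonnil (`hd (var 0F)))

keptF : ∀ {k d} → Path k → Path k → Path k → Path k → Formula k (4 + d)
keptF R S J u = subsetF u S and not (conflictF R u J)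

-- Quantification over one list is a parallel walk of the list with itself; the head of variable 1
-- is then the current member.
exchangeF : ∀ {k d} → (R P S J z : Path k) → Formula k (6 + d)
exchangeF R P S J z =
  elemF z J or some P P (keptF (wk R) (wk S) (wk J) (`hd (var 1F)) and elemF (wk z) (`hd (var 1F)))

clashF : ∀ {k d} → (R S J : Path k) → Formula k (4 + d)
clashF R S J = conflictF R J J or conflictF R S J

rejectedF : ∀ {k d} → (R P S J N u us : Path k) → Formula k (6 + d)
rejectedF R P S J N u us =
  subsetF u S or conflictF R u u or
  (conflictF R u N and
   (some P P (keptF (wk R) (wk S) (wk J) (`hd (var 1F)) and conflictF (wk R) (`hd (var 1F)) (wk u)) or
    some us us (subsetF (`hd (var 1F)) (wk S) and conflictF (wk R) (`hd (var 1F)) (wk u))))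

-- Formulas read sets but cannot construct them, so the child `N` is built in a variable beforehand.
-- The tail of variable 1 supplies the members behind the current one, as `Rejected` requires.
canonicalF : ∀ {k d} → (R P S J N : Path k) →
             Formula k (8 + d)
canonicalF R P S J N =
  not (conflictF R J J) and
  not (some P P (not (rejectedF (wk R) (wk P) (wk S) (wk J) (wk N) (`hd (var 1F)) (`tl (var 1F)))))

-- Formulas and the statements they express

encodeFamily : ∀ {n} → List (Subset n) → 𝔻
encodeFamily us = encodeList (map encodeSubset us)

encodeVec : ∀ {A : Set} {n} → (A → 𝔻) → Vec A n → 𝔻
encodeVec f xs = encodeList (map f (toList xs))

-- A record, so that the formula can be inferred from the type.
record Means {k d} (φ : Formula k d) (env : Vec 𝔻 k) (X : Set) : Set where
  constructor means
  field iff : Holds φ env ⇔ X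
open Means

module _ {k d : ℕ} {φ : Formula k d} {env : Vec 𝔻 k} where

  means-⇔ : ∀ {X Y} → Means φ env X → X ⇔ Y → Means φ env Y
  means-⇔ (means h) X⇔Y = means (⇔-trans h X⇔Y)

  not-means : ∀ {X} → Means φ env X → Means (not φ) env (¬ X)
  not-means (means h) = means (¬-cong-⇔ h)

  infixr 6 _and-means_
  infixr 5 _or-means_

  _and-means_ : ∀ {ψ X Y} → Means φ env X → Means ψ env Y → Means (φ and ψ) env (X × Y)
  means h and-means means h′ = means (h ×-⇔ h′)

  _or-means_ : ∀ {ψ X Y} → Means φ env X → Means ψ env Y → Means (φ or ψ) env (X ⊎ Y)
  means h or-means means h′ = means (h ⊎-⇔ h′)

bit-means : ∀ {k d n} {p : Path k} {env} (x : Fin n) A → ⟦ ⌞ p ⌟ ⟧ env ≡ encodeBool (lookup A x) →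
            Means {d = d} (nonnil p) env (x ∈ A)
bit-means {p = p} {env} x A eq with lookup A x in A[x]
... | true  = means (mk⇔ (λ _ → lookup⇒[]= x A A[x]) (λ _ e → contradiction (trans (sym eq) e) λ ()))
... | false = means (mk⇔ (λ ≢nil → contradiction eq ≢nil)
                         (λ x∈A _ → contradiction (trans (sym ([]=⇒lookup x∈A)) A[x]) λ ()))

module _ {k d : ℕ} {φ : Formula (2 + k) d} {env : Vec 𝔻 k} where

  private
    Q : 𝔻 → 𝔻 → Set
    Q a b = Holds φ (b ∷ a ∷ env)

  some-vec : ∀ {A B : Set} {f : A → 𝔻} {g : B → 𝔻} {n} {X : Fin n → Set} (xs : Vec A n) (ys : Vec B n) {p q} →
             ⟦ ⌞ p ⌟ ⟧ env ≡ encodeVec f xs → ⟦ ⌞ q ⌟ ⟧ env ≡ encodeVec g ys →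
             (∀ i {a b} → hd a ≡ f (lookup xs i) → hd b ≡ g (lookup ys i) → Means φ (b ∷ a ∷ env) (X i)) →
             Means (some p q φ) env (∃[ i ] X i)
  some-vec {f = f} {g} xs ys {p} {q} p≡ q≡ φ-means =
    means (subst₂ (λ a b → Some Q a b ⇔ _) (sym p≡) (sym q≡) (search xs ys φ-means))
    where
    search : ∀ {n} {X : Fin n → Set} xs ys →
             (∀ i {a b} → hd a ≡ f (lookup xs i) → hd b ≡ g (lookup ys i) → Means φ (b ∷ a ∷ env) (X i)) →
             Some Q (encodeVec f xs) (encodeVec g ys) ⇔ (∃[ i ] X i)
    search []       []       _ = mk⇔ (λ ()) (λ ())
    search {X = X} (x ∷ xs) (y ∷ ys) m = mk⇔ to from
      where
      rec = search {X = X ∘ suc} xs ys (m ∘ suc)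
      to : Some Q (encodeVec f (x ∷ xs)) (encodeVec g (y ∷ ys)) → ∃[ i ] X i
      to (inj₁ h) = zero , Equivalence.to (iff (m zero refl refl)) h
      to (inj₂ s) = let i , h = Equivalence.to rec s in suc i , h
      from : ∃[ i ] X i → Some Q (encodeVec f (x ∷ xs)) (encodeVec g (y ∷ ys))
      from (zero , h)  = inj₁ (Equivalence.from (iff (m zero refl refl)) h)
      from (suc i , h) = inj₂ (Equivalence.from rec (i , h))

  some-list : ∀ {A : Set} {f : A → 𝔻} {X : A → Set} xs {p q} → ⟦ ⌞ p ⌟ ⟧ env ≡ encodeList (map f xs) →
              (∀ x {a b} → hd a ≡ f x → Means φ (b ∷ a ∷ env) (X x)) →
              Means (some p q φ) env (Any X xs)
  some-list {f = f} {X} xs {p} p≡ φ-means = means (subst (λ a → Some Q a _ ⇔ _) (sym p≡) (search xs))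
    where
    search : ∀ xs {b} → Some Q (encodeList (map f xs)) b ⇔ Any X xs
    search []       = mk⇔ (λ ()) (λ ())
    search (x ∷ xs) = mk⇔
      (λ { (inj₁ h) → here (Equivalence.to (iff (φ-means x refl)) h) ; (inj₂ s) → there (Equivalence.to (search xs) s) })
      (λ { (here h) → inj₁ (Equivalence.from (iff (φ-means x refl)) h) ; (there s) → inj₂ (Equivalence.from (search xs) s) })

  -- Formulas are decidable, so the double negation can be removed. The body also learns the tail at
  -- which it is evaluated.
  every-tails : ∀ {A : Set} {f : A → 𝔻} {X : A → List A → Set} xs {p q} → ⟦ ⌞ p ⌟ ⟧ env ≡ encodeList (map f xs) →
                (∀ x xs {a b} → hd a ≡ f x → tl a ≡ encodeList (map f xs) → Means φ (b ∷ a ∷ env) (X x xs)) →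
                Means (not (some p q (not φ))) env (AllTails X xs)
  every-tails {f = f} {X} xs p≡ φ-means =
    means (subst (λ a → (¬ Some (λ a b → ¬ Q a b) a _) ⇔ _) (sym p≡) (mk⇔ (to xs) (from xs)))
    where
    to : ∀ xs {b} → ¬ Some (λ a b → ¬ Q a b) (encodeList (map f xs)) b → AllTails X xs
    to []       _  = []
    to (x ∷ xs) ¬s =
      Equivalence.to (iff (φ-means x xs refl refl)) (decidable-stable (holds? φ _) (¬s ∘ inj₁)) ∷ to xs (¬s ∘ inj₂)
    from : ∀ xs {b} → AllTails X xs → ¬ Some (λ a b → ¬ Q a b) (encodeList (map f xs)) b
    from (x ∷ xs) (h ∷ _)  (inj₁ ¬h) = ¬h (Equivalence.from (iff (φ-means x xs refl refl)) h)
    from (x ∷ xs) (_ ∷ hs) (inj₂ s)  = from xs hs s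

wk-denotes : ∀ {k} {env : Vec 𝔻 k} (p : Path k) {a b v} → ⟦ ⌞ p ⌟ ⟧ env ≡ v → ⟦ ⌞ wk p ⌟ ⟧ (b ∷ a ∷ env) ≡ v
wk-denotes p eq = trans (⟦wk⟧ p) eq

module _ {k d n : ℕ} (p q : Path k) {env : Vec 𝔻 k} where

  subsetF-means : ∀ {A B : Subset n} → ⟦ ⌞ p ⌟ ⟧ env ≡ encodeSubset A → ⟦ ⌞ q ⌟ ⟧ env ≡ encodeSubset B →
                  Means (subsetF {d = d} p q) env (A ⊆ B)
  subsetF-means {A} {B} p≡ q≡ = means-⇔
    (not-means (some-vec A B p≡ q≡ λ x a≡ b≡ → bit-means x A a≡ and-means not-means (bit-means x B b≡)))
    (mk⇔ (λ ¬∃ {x} x∈A → decidable-stable (x ∈? B) λ x∉B → ¬∃ (x , x∈A , x∉B))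
         (λ A⊆B (x , x∈A , x∉B) → x∉B (A⊆B x∈A)))

  -- The walk has taken exactly `toℕ x` steps when the index list is down to one entry, and the bit
  -- then at hand is that of `x`.
  elemF-means : ∀ {A : Subset n} {x} ds → length ds ≡ suc (toℕ x) →
                ⟦ ⌞ p ⌟ ⟧ env ≡ encodeList ds → ⟦ ⌞ q ⌟ ⟧ env ≡ encodeSubset A →
                Means (elemF {d = d} p q) env (x ∈ A)
  elemF-means {A} {x} ds len p≡ q≡ =
    means (subst₂ (λ a b → Some (λ a b → ¬ (tl a ≢ nil) × hd b ≢ nil) a b ⇔ _) (sym p≡) (sym q≡) (search x A ds len))
    where
    search : ∀ {n} (x : Fin n) A ds → length ds ≡ suc (toℕ x) →
             Some (λ a b → ¬ (tl a ≢ nil) × hd b ≢ nil) (encodeList ds) (encodeSubset A) ⇔ (x ∈ A)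
    search zero (true ∷ _) (_ ∷ []) _ =
      mk⇔ (λ _ → here) (λ _ → inj₁ ((λ ≢nil → ≢nil refl) , λ ()))
    search zero (false ∷ _) (_ ∷ []) _ =
      mk⇔ (λ { (inj₁ (_ , ≢nil)) → contradiction refl ≢nil ; (inj₂ ()) }) λ ()
    search (suc x) (_ ∷ A) (_ ∷ d ∷ ds) len = mk⇔
      (λ { (inj₁ (¬tl , _)) → ⊥-elim (¬tl λ ())
         ; (inj₂ s) → there (Equivalence.to (search x A (d ∷ ds) (suc-injective len)) s) })
      (λ { (there x∈A) → inj₂ (Equivalence.from (search x A (d ∷ ds) (suc-injective len)) x∈A) })

module Reflection (F : AF) where
  open AF F
  open Preferences F

  module _ {k} (R : Path k) {env : Vec 𝔻 k} (R≡ : ⟦ ⌞ R ⌟ ⟧ env ≡ encodeAF F) where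

    attackF-means : ∀ {d A B} p q → ⟦ ⌞ p ⌟ ⟧ env ≡ encodeSubset A → ⟦ ⌞ q ⌟ ⟧ env ≡ encodeSubset B →
                    Means (attackF {d = d} R p q) env (∃[ x ] (x ∈ A × ∃[ y ] (x ⇝ y × y ∈ B)))
    attackF-means {d} {A} {B} p q p≡ q≡ =
      some-vec A attackedBy p≡ R≡ λ x a≡ r≡ → bit-means x A a≡ and-means
        some-vec (lookup attackedBy x) B r≡ (wk-denotes q q≡) λ y row≡ b≡ →
          bit-means y (lookup attackedBy x) row≡ and-means bit-means y B b≡

    conflictF-means : ∀ {d A B} p q → ⟦ ⌞ p ⌟ ⟧ env ≡ encodeSubset A → ⟦ ⌞ q ⌟ ⟧ env ≡ encodeSubset B →
                      Means (conflictF {d = d} R p q) env (A # B)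
    conflictF-means p q p≡ q≡ = means-⇔ (attackF-means p q p≡ q≡ or-means attackF-means q p q≡ p≡) (mk⇔
      (λ { (inj₁ (x , x∈A , y , x⇝y , y∈B)) → x , y , x∈A , y∈B , inj₁ x⇝y
         ; (inj₂ (y , y∈B , x , y⇝x , x∈A)) → x , y , x∈A , y∈B , inj₂ y⇝x })
      (λ { (x , y , x∈A , y∈B , inj₁ x⇝y) → inj₁ (x , x∈A , y , x⇝y , y∈B)
         ; (x , y , x∈A , y∈B , inj₂ y⇝x) → inj₂ (y , y∈B , x , y⇝x , x∈A) }))

    keptF-means : ∀ {d S J A} s j u → ⟦ ⌞ s ⌟ ⟧ env ≡ encodeSubset S → ⟦ ⌞ j ⌟ ⟧ env ≡ encodeSubset J →
                  ⟦ ⌞ u ⌟ ⟧ env ≡ encodeSubset A → Means (keptF {d = d} R s j u) env (Kept S J A)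
    keptF-means s j u s≡ j≡ u≡ = subsetF-means u s u≡ s≡ and-means not-means (conflictF-means u j u≡ j≡)

  module _ {k} (R p s j : Path k) {P : List (Subset n)} {S J : Subset n} {env : Vec 𝔻 k}
           (R≡ : ⟦ ⌞ R ⌟ ⟧ env ≡ encodeAF F) (p≡ : ⟦ ⌞ p ⌟ ⟧ env ≡ encodeFamily P)
           (s≡ : ⟦ ⌞ s ⌟ ⟧ env ≡ encodeSubset S) (j≡ : ⟦ ⌞ j ⌟ ⟧ env ≡ encodeSubset J) where

    exchangeF-means : ∀ {d x} z ds → ⟦ ⌞ z ⌟ ⟧ env ≡ encodeList ds → length ds ≡ suc (toℕ x) →
                      Means (exchangeF {d = d} R p s j z) env (x ∈ exchange P S J)
    exchangeF-means z ds z≡ len = means-⇔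
      (elemF-means z j ds len z≡ j≡ or-means
       some-list P p≡ λ u u≡ →
         keptF-means (wk R) (wk-denotes R R≡) (wk s) (wk j) (`hd (var 1F)) (wk-denotes s s≡) (wk-denotes j j≡) u≡ and-means
         elemF-means (wk z) (`hd (var 1F)) ds len (wk-denotes z z≡) u≡)
      (mk⇔ (∈-exchange⁺ P S J) (∈-exchange⁻ P S J))

    clashF-means : ∀ {d} → Means (clashF {d = d} R s j) env (Clash S J)
    clashF-means = conflictF-means R R≡ j j j≡ j≡ or-means conflictF-means R R≡ s j s≡ j≡

    rejectedF-means : ∀ {d} m u us {A As} → ⟦ ⌞ m ⌟ ⟧ env ≡ encodeSubset (exchange P S J) →
                      ⟦ ⌞ u ⌟ ⟧ env ≡ encodeSubset A → ⟦ ⌞ us ⌟ ⟧ env ≡ encodeFamily As →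
                      Means (rejectedF {d = d} R p s j m u us) env (Rejected P S J A As)
    rejectedF-means m u us {As = As} m≡ u≡ us≡ =
      subsetF-means u s u≡ s≡ or-means conflictF-means R R≡ u u u≡ u≡ or-means
      (conflictF-means R R≡ u m u≡ m≡ and-means
       (some-list P p≡ (λ w w≡ →
          keptF-means (wk R) (wk-denotes R R≡) (wk s) (wk j) (`hd (var 1F)) (wk-denotes s s≡) (wk-denotes j j≡) w≡ and-means
          conflictF-means (wk R) (wk-denotes R R≡) (`hd (var 1F)) (wk u) w≡ (wk-denotes u u≡)) or-means
        some-list As us≡ (λ w w≡ →
          subsetF-means (`hd (var 1F)) (wk s) w≡ (wk-denotes s s≡) and-means
          conflictF-means (wk R) (wk-denotes R R≡) (`hd (var 1F)) (wk u) w≡ (wk-denotes u u≡))))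

  canonicalF-means : ∀ {k d} (R p s j m : Path k) {P S J} {env : Vec 𝔻 k} →
                     ⟦ ⌞ R ⌟ ⟧ env ≡ encodeAF F → ⟦ ⌞ p ⌟ ⟧ env ≡ encodeFamily P →
                     ⟦ ⌞ s ⌟ ⟧ env ≡ encodeSubset S → ⟦ ⌞ j ⌟ ⟧ env ≡ encodeSubset J →
                     ⟦ ⌞ m ⌟ ⟧ env ≡ encodeSubset (exchange P S J) →
                     Means (canonicalF {d = d} R p s j m) env (Canonical P S J)
  canonicalF-means R p s j m {P} R≡ p≡ s≡ j≡ m≡ =
    not-means (conflictF-means R R≡ j j j≡ j≡) and-means
    every-tails P p≡ λ u us u≡ us≡ →
      rejectedF-means (wk R) (wk p) (wk s) (wk j) (wk-denotes R R≡) (wk-denotes p p≡) (wk-denotes s s≡) (wk-denotes j j≡)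
        (wk m) (`hd (var 1F)) (`tl (var 1F)) (wk-denotes m m≡) u≡ us≡

-- The enumeration program

-- The variables of the main loop hold the attack matrix, a stack of nodes, the
-- current node, a position and a set under construction.  A node consists of
-- the sets processed so far, the union of those chosen, and the sets to come.
donePath chosenPath todoPath nextPath : Path 5
donePath   = `hd (var 2F)
chosenPath = `hd (`tl (var 2F))
todoPath   = `tl (`tl (var 2F))
nextPath   = `hd todoPath

exchangeΦ clashΦ canonicalΦ emptyΦ : Formula 5 8
exchangeΦ  = exchangeF (var 0F) donePath chosenPath nextPath (var 3F)
clashΦ     = clashF (var 0F) chosenPath nextPath
canonicalΦ = canonicalF (var 0F) donePath chosenPath nextPath (var 4F)
-- Before the search the node variable is nil.
emptyΦ     = nonnil (var 2F)

-- The attack matrix serves as the counter: m + 1 remaining rows encode the argument m. Bits are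
-- thus decided from the last to the first, which is the order in which `cons` assembles the list.
buildLoop build : Formula 5 8 → Cmd 14
buildLoop φ =
  while lift 8 (var 3F) loop
    (compile φ ⨾
     (if var zero then set 8 4F (`cons `true (var 4F)) else set 8 4F (`cons `nil (var 4F))) ⨾
     set 8 3F (`tl (var 3F)))
build φ = set 8 4F `nil ⨾ set 8 3F (var 0F) ⨾ buildLoop φ

when : Formula 5 8 → Expr 5 → Cmd 14
when φ e = compile φ ⨾ (if var zero then set 8 1F e else skip)

push : Path 5 → Expr 5
push p = `cons (`cons (`cons ⌞ nextPath ⌟ ⌞ donePath ⌟) (`cons ⌞ p ⌟ (`tl ⌞ todoPath ⌟))) (var 1F)

-- When this is evaluated, variable 1 still holds the input family instead of a stack, and variable
-- 4 the empty set.
rootStack : Expr 5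
rootStack = `cons (`cons `nil (`cons (var 4F) (var 1F))) `nil

-- The unchanged child is pushed before the exchanged one and so visited after it, in agreement with
-- `leaves`.
expand process visit search initialise : Cmd 14
expand     = build exchangeΦ ⨾ when clashΦ (push chosenPath) ⨾ when canonicalΦ (push (var 4F))
process    = if lift 8 ⌞ todoPath ⌟ then expand else output (lift 8 ⌞ chosenPath ⌟)
visit      = set 8 2F (`hd (var 1F)) ⨾ set 8 1F (`tl (var 1F)) ⨾ process
search     = while lift 8 (var 1F) loop visit
initialise =
  -- The input arrives in the result register and must be unpacked before a formula overwrites it.
  suc (place 8 1F) ≔ `tl (var zero) ⨾ suc (place 8 0F) ≔ `hd (var zero) ⨾ build emptyΦ ⨾
  set 8 1F rootStack

program : Program
program = record { body = initialise ⨾ search }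

-- Of the 11 units per turn, 2 inspect the register, 6 pay for the dearer of the two extensions and
-- 3 shorten the counter.
buildTime : Formula 5 8 → ℕ → ℕ
buildTime φ B = 2 + (2 + (B * (2 + (time φ B + 11)) + 2))

whenTime : Formula 5 8 → Expr 5 → ℕ → ℕ
whenTime φ e B = time φ B + (2 + setTime 8 e)

-- Abstract, as unfolding them produces huge terms.
abstract
  expandTime initialTime : ℕ → ℕ
  expandTime B =
    buildTime exchangeΦ B + (whenTime clashΦ (push chosenPath) B + whenTime canonicalΦ (push (var 4F)) B)
  initialTime B = 3 + (3 + (buildTime emptyΦ B + setTime 8 rootStack))

  expandTime-≡ : ∀ B → expandTime B ≡
    buildTime exchangeΦ B + (whenTime clashΦ (push chosenPath) B + whenTime canonicalΦ (push (var 4F)) B)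
  expandTime-≡ B = refl

  initialTime-≡ : ∀ B → initialTime B ≡
    3 + (3 + (buildTime emptyΦ B + setTime 8 rootStack))
  initialTime-≡ B = refl

-- Popping costs 8, namely 2 for the loop test and 3 for each of two assignments. A leaf then needs
-- 4 to test `todoPath` and 4 to output, 16 in all; an inner node needs 12 besides `expandTime`.
visitTime : ℕ → ℕ
visitTime B = 16 + expandTime B

encodeBits : List Bool → 𝔻
encodeBits bs = encodeList (map encodeBool bs)

encodeBits-size : ∀ bs → ∣ encodeBits bs ∣ ≤ 1 + length bs * 4
encodeBits-size []       = ≤-refl
encodeBits-size (b ∷ bs) = s≤s (+-mono-≤ (bit b) (encodeBits-size bs))
  where
  bit : ∀ b → ∣ encodeBool b ∣ ≤ 3
  bit true  = ≤-refl
  bit false = s≤s z≤n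

drop-toList : ∀ {A : Set} {n} (x : Fin n) (xs : Vec A n) →
              drop (toℕ x) (toList xs) ≡ lookup xs x ∷ drop (suc (toℕ x)) (toList xs)
drop-toList zero    (_ ∷ _)  = refl
drop-toList (suc x) (_ ∷ xs) = drop-toList x xs

pick : ∀ {X A : Set} → Dec X → A → A → A
pick (yes _) a b = a
pick (no _)  a b = b

-- Correctness and cost of the program on one framework

module Search (F : AF) (B : ℕ) (3≤B : 3 ≤ B) (fits-rows : ∣ encodeAF F ∣ ≤ B)
              (fits-bits : 1 + AF.n F * 4 ≤ B) (n≤B : AF.n F ≤ B) where
  open AF F
  open Preferences F
  open Bounded B 3≤B
  open Reflection F

  vars : 𝔻 → 𝔻 → 𝔻 → 𝔻 → Vec 𝔻 5
  vars stack node z N = encodeAF F ∷ stack ∷ node ∷ z ∷ N ∷ []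

  smalls : ∀ {stack node z N} → Small stack → Small node → Small z → Small N → All Small (vars stack node z N)
  smalls a b c d = fits-rows ∷ a ∷ b ∷ c ∷ d ∷ []

  small-bits : ∀ bs → length bs ≤ n → Small (encodeBits bs)
  small-bits bs len = ≤-trans (encodeBits-size bs) (≤-trans (s≤s (*-monoˡ-≤ 4 len)) fits-bits)

  small-subset : ∀ S → Small (encodeSubset S)
  small-subset S = small-bits (toList S) (≤-reflexive (length-toList S))

  Reaches : Cmd 14 → Store 14 → Vec 𝔻 5 → ℕ → Set
  Reaches c σ env t =
    ∃[ r ] Σ[ s ∈ Vec 𝔻 8 ] (Small r × All Small s × Runs c σ (state r s env) t)

  module _ (φ : Formula 5 8) (X : Subset n) {stack node : 𝔻} (small-stack : Small stack) (small-node : Small node)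
           (φ-means : ∀ {x N} ds → length ds ≡ suc (toℕ x) → Means φ (vars stack node (encodeList ds) N) (x ∈ X)) where

    bits : ℕ → 𝔻
    bits m = encodeBits (drop m (toList X))

    small-drop : ∀ m → Small (bits m)
    small-drop m = small-bits (drop m (toList X))
      (≤-trans (≤-reflexive (length-drop m (toList X))) (≤-trans (m∸n≤m _ m) (≤-reflexive (length-toList X))))

    -- The invariant: with m entries left in the counter, the set under construction holds the bits
    -- of `X` from position m on.
    build-loop : ∀ ds → length ds ≤ n → ∀ {r} {s : Vec 𝔻 8} → Small r → All Small s → Small (encodeList ds) →
                 Reaches (buildLoop φ) (state r s (vars stack node (encodeList ds) (bits (length ds))))
                         (vars stack node nil (encodeSubset X)) (length ds * (2 + (time φ B + 11)) + 2)
    build-loop [] len {r} {s} small-r small-s small-ds =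
      r , s , small-r , small-s ,
      runs-exit (fits-state small-r small-s (smalls small-stack small-node small-ds (small-drop 0))) (⟦lift⟧ (var 3F) r s _)
    build-loop (d ∷ ds) len {r} {s} small-r small-s small-ds
      with compile-decides φ {env = vars stack node (encodeList (d ∷ ds)) (bits (suc (length ds)))}
             small-r small-s (smalls small-stack small-node small-ds (small-drop (suc (length ds))))
    ... | r₁ , s₁ , small-r₁ , small-s₁ , verdict , run =
      let r₂ , s₂ , small-r₂ , small-s₂ , run₂ = build-loop ds (≤-trans (n≤1+n _) len) small-r₁ small-s₁ small-ds′
      in r₂ , s₂ , small-r₂ , small-s₂ ,
         runs-≤ bound
           (runs-loop {e = lift 8 (var 3F)} (fits-state small-r small-s (smalls small-stack small-node small-ds small-N))
             (subst Small (sym (⟦lift⟧ (var 3F) r s _)) small-ds)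
             (λ e → contradiction (trans (sym (⟦lift⟧ (var 3F) r s (vars stack node (encodeList (d ∷ ds)) _))) e) λ ())
             (run ▷ extend verdict ▷
              runs-set 3F (`tl (var 3F)) small-r₁ small-s₁ (smalls small-stack small-node small-ds small-N′) refl small-ds′)
             run₂)
      where
      m = length ds
      C = 2 + (time φ B + 11)
      x : Fin n
      x = fromℕ< len
      x≡ : toℕ x ≡ m
      x≡ = toℕ-fromℕ< len
      small-N : Small (bits (suc m))
      small-N = small-drop (suc m)
      small-N′ : Small (bits m)
      small-N′ = small-drop m
      small-ds′ : Small (encodeList ds)
      small-ds′ = ≤-trans (m≤n+m _ (suc ∣ d ∣)) small-ds
      x∈X = φ-means {x} {bits (suc m)} (d ∷ ds) (cong suc (sym x≡))
      bits≡ : ∀ {b} → lookup X x ≡ b → cons (encodeBool b) (bits (suc m)) ≡ bits m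
      bits≡ refl = subst (λ k → cons (encodeBool (lookup X x)) (bits (suc k)) ≡ bits k) x≡
                         (cong encodeBits (sym (drop-toList x X)))
      lookup-∉ : ¬ x ∈ X → lookup X x ≡ false
      lookup-∉ x∉X with lookup X x in eq
      ... | true  = contradiction (lookup⇒[]= x X eq) x∉X
      ... | false = refl
      env = vars stack node (encodeList (d ∷ ds)) (bits (suc m))
      small-env : All Small env
      small-env = smalls small-stack small-node small-ds small-N
      extend : Verdict r₁ (Holds φ env) →
               Runs (if var zero then set 8 4F (`cons `true (var 4F)) else set 8 4F (`cons `nil (var 4F)))
                    (state r₁ s₁ env) (state r₁ s₁ (vars stack node (encodeList (d ∷ ds)) (bits m))) 8
      extend (holds r₁≢nil h) =
        runs-then {e = var zero} (fits-state small-r₁ small-s₁ small-env) small-r₁ r₁≢nil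
          (runs-set 4F (`cons `true (var 4F)) small-r₁ small-s₁ small-env
            (bits≡ ([]=⇒lookup (Equivalence.to (Means.iff x∈X) h))) small-N′)
      extend (fails r₁≡nil ¬h) = runs-≤ (m≤m+n 6 2)
        (runs-else {e = var zero} (fits-state small-r₁ small-s₁ small-env) r₁≡nil
          (runs-set 4F (`cons `nil (var 4F)) small-r₁ small-s₁ small-env
            (bits≡ (lookup-∉ (¬h ∘ Equivalence.from (Means.iff x∈X)))) small-N′))
      bound : 2 + (time φ B + 11 + (m * C + 2)) ≤ suc m * C + 2
      bound = ≤-reflexive (sym (+-assoc C (m * C) 2))

    build-runs : ∀ {r} {s : Vec 𝔻 8} {z N} → Small r → All Small s → Small z → Small N →
                 Reaches (build φ) (state r s (vars stack node z N)) (vars stack node nil (encodeSubset X)) (buildTime φ B)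
    build-runs {r} {s} small-r small-s small-z small-N =
      let r₁ , s₁ , small-r₁ , small-s₁ , run = build-loop rows (≤-reflexive rows-length) small-r small-s fits-rows
      in r₁ , s₁ , small-r₁ , small-s₁ ,
         runs-set 4F `nil small-r small-s (smalls small-stack small-node small-z small-N) refl small-nil ▷
         runs-set 3F (var 0F) small-r small-s (smalls small-stack small-node small-z small-nil) refl fits-rows ▷
         runs-≤ (+-monoˡ-≤ 2 (*-monoˡ-≤ (2 + (time φ B + 11)) (≤-trans (≤-reflexive rows-length) n≤B)))
           (subst (λ N → Runs (buildLoop φ) (state r s (vars stack node (encodeAF F) N))
                              (state r₁ s₁ (vars stack node nil (encodeSubset X))) _)
                  -- At the start all n rows remain, and no bits lie from position n on, so the
                  -- invariant holds for `nil`.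
                  (cong encodeBits (drop-all (length rows) (toList X)
                    (≤-reflexive (trans (length-toList X) (sym rows-length)))))
                  run)
      where
      rows = map encodeSubset (toList attackedBy)
      rows-length : length rows ≡ n
      rows-length = trans (length-map encodeSubset (toList attackedBy)) (length-toList attackedBy)

  when-runs : ∀ φ e {v X} (X? : Dec X) {r} {s : Vec 𝔻 8} {stack node z N} → Means φ (vars stack node z N) X →
              ⟦ e ⟧ (vars stack node z N) ≡ v → Small v →
              Small r → All Small s → Small stack → Small node → Small z → Small N →
              Reaches (when φ e) (state r s (vars stack node z N)) (vars (pick X? v stack) node z N) (whenTime φ e B)
  when-runs φ e {v} {X} X? {stack = stack} {node} {z} {N} (means h) e≡ small-v
            small-r small-s small-stack small-node small-z small-N
    with compile-decides φ {env = vars stack node z N} small-r small-s (smalls small-stack small-node small-z small-N)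
  ... | r₁ , s₁ , small-r₁ , small-s₁ , verdict , run =
    r₁ , s₁ , small-r₁ , small-s₁ , run ▷ choose X? verdict
    where
    env = vars stack node z N
    small-env : All Small env
    small-env = smalls small-stack small-node small-z small-N
    fits = fits-state small-r₁ small-s₁ small-env
    choose : ∀ X? → Verdict r₁ (Holds φ env) →
             Runs (if var zero then set 8 1F e else skip) (state r₁ s₁ env)
                  (state r₁ s₁ (vars (pick X? v stack) node z N)) (2 + setTime 8 e)
    choose (yes _) (holds r₁≢nil _) =
      runs-then {e = var zero} fits small-r₁ r₁≢nil (runs-set 1F e small-r₁ small-s₁ small-env e≡ small-v)
    choose (no _) (fails r₁≡nil _) =
      runs-≤ (+-monoʳ-≤ 2 (s≤s z≤n)) (runs-else {e = var zero} fits r₁≡nil (runs-skip fits))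
    choose (yes x) (fails _ ¬h)  = contradiction (Equivalence.from h x) ¬h
    choose (no ¬x) (holds _ h′) = contradiction (Equivalence.to h h′) ¬x

  node : List (Subset n) → Subset n → List (Subset n) → 𝔻
  node P S Q = cons (encodeFamily P) (cons (encodeSubset S) (encodeFamily Q))

  expand-runs : ∀ P S J Q (c? : Dec (Canonical P S J)) (cl? : Dec (Clash S J)) {r} {s : Vec 𝔻 8} {stack z N} →
    let kept  = cons (node (J ∷ P) S Q) stack
        stack₁ = pick cl? kept stack
        new   = cons (node (J ∷ P) (exchange P S J) Q) stack₁
    in Small kept → Small new → Small r → All Small s → Small stack → Small (node P S (J ∷ Q)) → Small z → Small N →
       Reaches expand (state r s (vars stack (node P S (J ∷ Q)) z N))
               (vars (pick c? new stack₁) (node P S (J ∷ Q)) nil (encodeSubset (exchange P S J))) (expandTime B)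
  expand-runs P S J Q c? cl? {stack = stack} small-kept small-new small-r small-s small-stack small-node small-z small-N =
    let r₁ , s₁ , small-r₁ , small-s₁ , run₁ =
          build-runs exchangeΦ (exchange P S J) small-stack small-node
            (λ ds len → exchangeF-means (var 0F) donePath chosenPath nextPath refl refl refl refl (var 3F) ds refl len)
            small-r small-s small-z small-N
        r₂ , s₂ , small-r₂ , small-s₂ , run₂ =
          when-runs clashΦ (push chosenPath) cl?
            (clashF-means (var 0F) donePath chosenPath nextPath {P} refl refl refl refl) refl small-kept
            small-r₁ small-s₁ small-stack small-node small-nil (small-subset (exchange P S J))
        r₃ , s₃ , small-r₃ , small-s₃ , run₃ =
          when-runs canonicalΦ (push (var 4F)) c?
            (canonicalF-means (var 0F) donePath chosenPath nextPath (var 4F) refl refl refl refl refl) refl small-new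
            small-r₂ small-s₂ (≤-trans (m≤n+m _ _) (≤-trans (n≤1+n _) small-new)) small-node small-nil
            (small-subset (exchange P S J))
    in r₃ , s₃ , small-r₃ , small-s₃ , runs-≤ (≤-reflexive (sym (expandTime-≡ B))) (run₁ ▷ run₂ ▷ run₃)

  -- Accounting for delays along the search

  module Delay (D : ℕ) where

    -- Here `b` bounds the time already elapsed since the last output. Quantifying over all
    -- accumulators up to `b` makes the bound monotone and lets a silent prefix be charged against
    -- it.
    record Good (ys : List 𝔻) (b : ℕ) (τ : Trace) : Set where
      field
        good-outputs : outputs τ ≡ ys
        good-spaces  : List.All (_≤ spaceBound 14) (spaces τ)
        good-delays  : ∀ {a} → a ≤ b → List.All (_≤ D) (delaysFrom a τ)
    open Good public

    good-[] : ∀ {b} → b ≤ D → Good [] b []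
    good-[] b≤D = record { good-outputs = refl ; good-spaces = [] ; good-delays = λ a≤b → ≤-trans a≤b b≤D ∷ [] }

    good-emit : ∀ {d y ys b τ} → d ≡ y → b ≤ D → Good ys 0 τ → Good (y ∷ ys) b (emit d ∷ τ)
    good-emit refl b≤D g = record
      { good-outputs = cong (_ ∷_) (good-outputs g)
      ; good-spaces  = good-spaces g
      ; good-delays  = λ a≤b → ≤-trans a≤b b≤D ∷ good-delays g z≤n
      }

    good-++ : ∀ {ys b c t τ τ′} → Silent (spaceBound 14) t τ → c + t ≤ b → Good ys b τ′ → Good ys c (τ ++ τ′)
    good-++ {c = c} [] c+t≤b g = record
      { good-outputs = good-outputs g
      ; good-spaces  = good-spaces g
      ; good-delays  = λ a≤c → good-delays g (≤-trans a≤c (≤-trans (m≤m+n c _) c+t≤b))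
      }
    good-++ {ys} {b} {c} (step {t} {t′} {w} s≤ w+t≤t′ q) c+t≤b g = record
      { good-outputs = good-outputs g′
      ; good-spaces  = s≤ ∷ good-spaces g′
      ; good-delays  = λ a≤c → good-delays g′ (+-monoˡ-≤ w a≤c)
      }
      where
      g′ : Good ys (c + w) _
      g′ = good-++ q (≤-trans (≤-reflexive (+-assoc c w t)) (≤-trans (+-monoʳ-≤ c w+t≤t′) c+t≤b)) g

    -- The main loop is entered b time units after the last output.
    record Empties (b : ℕ) (stack : 𝔻) (ys : List 𝔻) : Set where
      constructor empties
      field
        search-run : ∀ {r} {s : Vec 𝔻 8} {node z N} →
          Small r → All Small s → Small node → Small z → Small N →
          ∃[ τ ] ∃[ σ ] (⟨ search , state r s (vars stack node z N) ⟩⇓⟨ τ , σ ⟩ × Good ys b τ)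
    open Empties public

    empties-nil : ∀ {b} → b + 2 ≤ D → Empties b nil []
    empties-nil b≤D = empties λ {r} {s} small-r small-s small-node small-z small-N →
      _ , _ , ⇓-exit (⟦lift⟧ (var 1F) r s _) ,
      good-++ (evaluated {e = lift 8 (var 1F)} {t = 0}
                 (fits-state small-r small-s (smalls small-nil small-node small-z small-N))
                 (subst Small (sym (⟦lift⟧ (var 1F) r s _)) small-nil) [])
              ≤-refl (good-[] b≤D)

    empties-cons : ∀ {b node stack ys} → Small (cons node stack) →
      (∀ {r} {s : Vec 𝔻 8} {z N} → Small r → All Small s → Small z → Small N →
         ∃[ τ ] ∃[ σ ] ∃[ τ′ ] ∃[ σ′ ]
           (⟨ process , state r s (vars stack node z N) ⟩⇓⟨ τ , σ ⟩ × ⟨ search , σ ⟩⇓⟨ τ′ , σ′ ⟩ ×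
            Good ys (b + 8) (τ ++ τ′))) →
      Empties b (cons node stack) ys
    empties-cons {b} {node} {stack} {ys} small-stack continue = empties run
      where
      small-node : Small node
      small-node = small-left node stack small-stack
      run : ∀ {r} {s : Vec 𝔻 8} {node₀ z N} →
        Small r → All Small s → Small node₀ → Small z → Small N →
        ∃[ τ ] ∃[ σ ] (⟨ search , state r s (vars (cons node stack) node₀ z N) ⟩⇓⟨ τ , σ ⟩ × Good ys b τ)
      run {r} {s} {node₀} {z} {N} small-r small-s small-node₀ small-z small-N =
        let τ₁ , run₁ , silent₁ = popped
            τ₂ , run₂ , silent₂ = advanced
            τ₃ , σ₃ , τ₄ , σ₄ , run₃ , run₄ , good = continue small-r small-s small-z small-N
            rearranged : (τ₁ ++ τ₂) ++ (τ₃ ++ τ₄) ≡ (τ₁ ++ (τ₂ ++ τ₃)) ++ τ₄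
            rearranged = trans (++-assoc τ₁ τ₂ (τ₃ ++ τ₄)) (trans (cong (τ₁ ++_) (sym (++-assoc τ₂ τ₃ τ₄)))
                                                                 (sym (++-assoc τ₁ (τ₂ ++ τ₃) τ₄)))
        in _ , _ ,
           ⇓-loop (λ e → contradiction (trans (sym head) e) λ ()) (⇓-seq run₁ (⇓-seq run₂ run₃)) run₄ ,
           subst (λ τ → Good ys b (evaluating (lift 8 (var 1F)) σ₀ ∷ τ)) rearranged
             (good-++ (evaluated {e = lift 8 (var 1F)} fits (subst Small (sym head) small-stack) (silent-++ silent₁ silent₂))
                      ≤-refl good)
        where
        σ₀ = state r s (vars (cons node stack) node₀ z N)
        head : ⟦ lift 8 (var 1F) ⟧ σ₀ ≡ cons node stack
        head = ⟦lift⟧ (var 1F) r s _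
        fits : All Small σ₀
        fits = fits-state small-r small-s (smalls small-stack small-node₀ small-z small-N)
        popped : Runs (set 8 2F (`hd (var 1F))) σ₀ (state r s (vars (cons node stack) node z N)) 3
        popped = runs-set 2F (`hd (var 1F)) small-r small-s (smalls small-stack small-node₀ small-z small-N) refl small-node
        advanced : Runs (set 8 1F (`tl (var 1F))) (state r s (vars (cons node stack) node z N))
                        (state r s (vars stack node z N)) 3
        advanced = runs-set 1F (`tl (var 1F)) small-r small-s (smalls small-stack small-node small-z small-N) refl
                     (small-right node stack small-stack)

    T : ℕ
    T = visitTime B

    empties-leaf : ∀ {b P S stack ys} → Small (cons (node P S []) stack) → b + 16 ≤ D →
                   Empties 0 stack ys → Empties b (cons (node P S []) stack) (encodeSubset S ∷ ys)
    empties-leaf {b} {P} {S} {stack} {ys} small-stack b≤D rest =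
      empties-cons small-stack λ {r} {s} {z} {N} small-r small-s small-z small-N →
        let env = vars stack (node P S []) z N
            small-node = small-left (node P S []) stack small-stack
            fits = fits-state {r = r} {s} {env} small-r small-s
                     (smalls (small-right (node P S []) stack small-stack) small-node small-z small-N)
            done = ⟦lift⟧ ⌞ todoPath ⌟ r s env
            out  = ⟦lift⟧ ⌞ chosenPath ⌟ r s env
            τ′ , σ′ , run′ , good = search-run rest small-r small-s small-node small-z small-N
        in _ , _ , τ′ , σ′ , ⇓-else done ⇓-output , run′ ,
           good-++ (evaluated {e = lift 8 ⌞ todoPath ⌟} fits (subst Small (sym done) small-nil)
                     (evaluated {e = lift 8 ⌞ chosenPath ⌟} {t = 0} fits (subst Small (sym out) (small-subset S)) []))
                   (≤-reflexive (+-assoc b 8 8)) (good-emit out b≤D good)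

    empties-node : ∀ {b P S J Q stack ys} (c? : Dec (Canonical P S J)) (cl? : Dec (Clash S J)) →
      let kept   = cons (node (J ∷ P) S Q) stack
          stack₁ = pick cl? kept stack
          new    = cons (node (J ∷ P) (exchange P S J) Q) stack₁
      in Small (cons (node P S (J ∷ Q)) stack) → Small kept → Small new →
         Empties (b + T) (pick c? new stack₁) ys → Empties b (cons (node P S (J ∷ Q)) stack) ys
    empties-node {b} {P} {S} {J} {Q} {stack} {ys} c? cl? small-stack small-kept small-new rest =
      empties-cons small-stack λ {r} {s} {z} {N} small-r small-s small-z small-N →
        let env = vars stack (node P S (J ∷ Q)) z N
            small-node = small-left (node P S (J ∷ Q)) stack small-stack
            small-tail = small-right (node P S (J ∷ Q)) stack small-stack
            fits = fits-state {r = r} {s} {env} small-r small-s (smalls small-tail small-node small-z small-N)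
            todo = ⟦lift⟧ ⌞ todoPath ⌟ r s env
            small-todo = small-path todoPath {env} (smalls small-tail small-node small-z small-N)
            r₁ , s₁ , small-r₁ , small-s₁ , (τ , run , silent) =
              expand-runs P S J Q c? cl? small-kept small-new small-r small-s small-tail small-node small-z small-N
            τ′ , σ′ , run′ , good = search-run rest small-r₁ small-s₁ small-node small-nil (small-subset (exchange P S J))
        in _ , _ , τ′ , σ′ , ⇓-then (λ e → contradiction (trans (sym todo) e) λ ()) run , run′ ,
           good-++ (evaluated {e = lift 8 ⌞ todoPath ⌟} fits (subst Small (sym todo) small-todo) silent)
                   (≤-trans (≤-reflexive (+-assoc b 8 (4 + expandTime B))) (+-monoʳ-≤ b (m≤n+m (12 + expandTime B) 4))) good

    module _ (c W : ℕ) (c≤W : 3 + (c + (1 + n * 4)) ≤ W) where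

      -- The summand 3 stands for the two cells of the node and the stack cell holding it. `c`
      -- bounds the two families together, a quantity that is the same for parent and child.
      node-size : ∀ P S Q → ∣ encodeFamily P ∣ + ∣ encodeFamily Q ∣ ≤ c → suc ∣ node P S Q ∣ ≤ W
      node-size P S Q size = ≤-trans (≤-reflexive (solve 3
          (λ p s q → con 2 :+ (p :+ (con 1 :+ (s :+ q))) := con 3 :+ ((p :+ q) :+ s)) refl
          (∣ encodeFamily P ∣) (∣ encodeSubset S ∣) (∣ encodeFamily Q ∣)))
        (≤-trans (+-monoʳ-≤ 3 (+-mono-≤ size subset-size)) c≤W)
        where
        open +-*-Solver
        subset-size : ∣ encodeSubset S ∣ ≤ 1 + n * 4
        subset-size = ≤-trans (encodeBits-size (toList S)) (≤-reflexive (cong (λ l → 1 + l * 4) (length-toList S)))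

      -- Room `W` is reserved in advance for each entry that may still be pushed; a push spends one
      -- such reservation.
      stack-size : ∀ {P S Q k stack} → ∣ encodeFamily P ∣ + ∣ encodeFamily Q ∣ ≤ c → ∣ stack ∣ + suc k * W ≤ B →
                   ∣ cons (node P S Q) stack ∣ + k * W ≤ B
      stack-size {P} {S} {Q} {k} {stack} size fits = ≤-trans
        (≤-trans (+-monoˡ-≤ (k * W) (+-monoˡ-≤ ∣ stack ∣ (node-size P S Q size)))
          (≤-reflexive (solve 3 (λ w s kw → w :+ s :+ kw := s :+ (w :+ kw)) refl W (∣ stack ∣) (k * W))))
        fits
        where open +-*-Solver

      -- Induction on `Q` with two credits. Each level spends one `T` of time, and one `W` of room
      -- because a node is replaced by at most two. Every subtree ends with an output, which resets
      -- the clock for the stack below it; hence `Empties 0` there.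
      empties-leaves : ∀ Q {P S stack ys b} → Maximal P S → ∣ encodeFamily P ∣ + ∣ encodeFamily Q ∣ ≤ c →
        ∣ stack ∣ + (1 + length Q) * W ≤ B → b + (1 + length Q) * T ≤ D → Empties 0 stack ys →
        Empties b (cons (node P S Q) stack) (map encodeSubset (leaves P S Q) ++ ys)
      empties-leaves [] {P} {S} {stack} {b = b} m size fits b≤D rest = empties-leaf {P = P} {S}
        (≤-trans (m≤m+n _ _) (stack-size {P} {S} {[]} {0} {stack} size fits))
        (≤-trans (+-monoʳ-≤ b (≤-trans (m≤m+n 16 _) (m≤m+n T 0))) b≤D) rest
      empties-leaves (J ∷ Q) {P} {S} {stack} {ys} {b} m size fits b≤D rest = branch
        where
        k = length Q
        size′ : ∣ encodeFamily (J ∷ P) ∣ + ∣ encodeFamily Q ∣ ≤ c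
        size′ = ≤-trans (≤-reflexive (solve 3 (λ j p q → con 1 :+ (j :+ p) :+ q := p :+ (con 1 :+ (j :+ q))) refl
                  (∣ encodeSubset J ∣) (∣ encodeFamily P ∣) (∣ encodeFamily Q ∣))) size
          where open +-*-Solver
        fits₁ : ∣ stack ∣ + (1 + k) * W ≤ B
        fits₁ = ≤-trans (+-monoʳ-≤ ∣ stack ∣ (m≤n+m _ W)) fits
        fits-kept : ∣ cons (node (J ∷ P) S Q) stack ∣ + (1 + k) * W ≤ B
        fits-kept = stack-size {J ∷ P} {S} {Q} {1 + k} {stack} size′ fits
        budget : b + T + (1 + k) * T ≤ D
        budget = ≤-trans (≤-reflexive (+-assoc b T _)) b≤D
        budget₀ : (1 + k) * T ≤ D
        budget₀ = ≤-trans (m≤n+m _ (b + T)) budget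
        small : Small (cons (node P S (J ∷ Q)) stack)
        small = ≤-trans (m≤m+n _ _) (stack-size {P} {S} {J ∷ Q} {1 + k} {stack} size fits)
        small-kept : Small (cons (node (J ∷ P) S Q) stack)
        small-kept = ≤-trans (m≤m+n _ _) fits-kept
        small-new : ∀ (cl? : Dec (Clash S J)) →
          Small (cons (node (J ∷ P) (exchange P S J) Q) (pick cl? (cons (node (J ∷ P) S Q) stack) stack))
        small-new (yes _) = ≤-trans (m≤m+n _ _)
          (stack-size {J ∷ P} {exchange P S J} {Q} {k} {cons (node (J ∷ P) S Q) stack} size′ fits-kept)
        small-new (no _)  = ≤-trans (m≤m+n _ _) (stack-size {J ∷ P} {exchange P S J} {Q} {k} {stack} size′ fits₁)
        kept-leaves = leaves (J ∷ P) S Q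
        new-leaves  = leaves (J ∷ P) (exchange P S J) Q
        expanded : ∀ {ys} (c? : Dec (Canonical P S J)) (cl? : Dec (Clash S J)) →
          let stack₁ = pick cl? (cons (node (J ∷ P) S Q) stack) stack
          in Empties (b + T) (pick c? (cons (node (J ∷ P) (exchange P S J) Q) stack₁) stack₁) ys →
             Empties b (cons (node P S (J ∷ Q)) stack) ys
        expanded c? cl? = empties-node {b} {P} {S} {J} {Q} {stack} c? cl? small small-kept (small-new cl?)
        branch : Empties b (cons (node P S (J ∷ Q)) stack) (map encodeSubset (leaves P S (J ∷ Q)) ++ ys)
        branch with canonical? P S J | clash? S J
        ... | yes c | yes cl = expanded (yes c) (yes cl)
          (subst (Empties (b + T) _)
            (trans (sym (++-assoc (map encodeSubset new-leaves) (map encodeSubset kept-leaves) ys))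
                   (cong (_++ ys) (sym (map-++ encodeSubset new-leaves kept-leaves))))
            (empties-leaves Q (child-maximal m (exchanged c)) size′ fits-kept budget
              (empties-leaves Q (child-maximal m (unchanged cl)) size′ fits₁ budget₀ rest)))
        ... | yes c | no ¬cl = expanded (yes c) (no ¬cl)
          (subst (λ us → Empties (b + T) (cons (node (J ∷ P) (exchange P S J) Q) stack) (map encodeSubset us ++ ys))
            (sym (++-identityʳ new-leaves))
            (empties-leaves Q (child-maximal m (exchanged c)) size′ fits₁ budget rest))
        ... | no ¬c | yes cl = expanded (no ¬c) (yes cl)
          (empties-leaves Q (child-maximal m (unchanged cl)) size′ fits₁ budget rest)
        -- A dead end would let time pile up over several branches without an output.
        ... | no ¬c | no ¬cl = contradiction (¬clash⇒canonical m ¬cl) ¬c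

-- Polynomial bounds

IsPolynomial : (ℕ → ℕ) → Set
IsPolynomial f = Σ[ p ∈ Polynomial ] (∀ x → evalPoly p x ≡ f x)

const-poly : ∀ c → IsPolynomial (λ _ → c)
const-poly c = c ∷ [] , λ x → trans (cong (c +_) (*-zeroʳ x)) (+-identityʳ c)

id-poly : IsPolynomial id
id-poly = 0 ∷ 1 ∷ [] , λ x → trans (cong (x *_) (cong suc (*-zeroʳ x))) (*-identityʳ x)

_⊕_ : Polynomial → Polynomial → Polynomial
[]      ⊕ q       = q
(a ∷ p) ⊕ []      = a ∷ p
(a ∷ p) ⊕ (b ∷ q) = (a + b) ∷ (p ⊕ q)

eval-⊕ : ∀ p q x → evalPoly (p ⊕ q) x ≡ evalPoly p x + evalPoly q x
eval-⊕ []      q       x = refl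
eval-⊕ (a ∷ p) []      x = sym (+-identityʳ _)
eval-⊕ (a ∷ p) (b ∷ q) x rewrite eval-⊕ p q x =
  solve 5 (λ a b x p q → a :+ b :+ x :* (p :+ q) := (a :+ x :* p) :+ (b :+ x :* q)) refl
        a b x (evalPoly p x) (evalPoly q x)
  where open +-*-Solver

_⊗_ : Polynomial → Polynomial → Polynomial
[]      ⊗ q = []
(a ∷ p) ⊗ q = map (a *_) q ⊕ (0 ∷ (p ⊗ q))

eval-scale : ∀ a q x → evalPoly (map (a *_) q) x ≡ a * evalPoly q x
eval-scale a []      x = sym (*-zeroʳ a)
eval-scale a (b ∷ q) x rewrite eval-scale a q x =
  solve 4 (λ a b x q → a :* b :+ x :* (a :* q) := a :* (b :+ x :* q)) refl a b x (evalPoly q x)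
  where open +-*-Solver

eval-⊗ : ∀ p q x → evalPoly (p ⊗ q) x ≡ evalPoly p x * evalPoly q x
eval-⊗ []      q x = refl
eval-⊗ (a ∷ p) q x rewrite eval-⊕ (map (a *_) q) (0 ∷ (p ⊗ q)) x | eval-scale a q x | eval-⊗ p q x =
  solve 4 (λ a x p q → a :* q :+ x :* (p :* q) := (a :+ x :* p) :* q) refl a x (evalPoly p x) (evalPoly q x)
  where open +-*-Solver

infixl 6 _+-poly_
infixl 7 _*-poly_

_+-poly_ : ∀ {f g} → IsPolynomial f → IsPolynomial g → IsPolynomial (λ x → f x + g x)
(p , p≡) +-poly (q , q≡) = p ⊕ q , λ x → trans (eval-⊕ p q x) (cong₂ _+_ (p≡ x) (q≡ x))

_*-poly_ : ∀ {f g} → IsPolynomial f → IsPolynomial g → IsPolynomial (λ x → f x * g x)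
(p , p≡) *-poly (q , q≡) = p ⊗ q , λ x → trans (eval-⊗ p q x) (cong₂ _*_ (p≡ x) (q≡ x))

module _ {f : ℕ → ℕ} (f-poly : IsPolynomial f) where

  -- With a polynomial substituted for `B` from the start, closure under sums and products is enough
  -- and polynomials never have to be composed.
  time-poly : ∀ {k d} (φ : Formula k d) → IsPolynomial (λ x → time φ (f x))
  time-poly {d = d} (nonnil p) = const-poly (setTime d ⌞ p ⌟)
  time-poly (not φ)   = time-poly φ +-poly const-poly 6
  time-poly (φ and ψ) = time-poly φ +-poly (const-poly 2 +-poly (const-poly 1 +-poly time-poly ψ))
  time-poly (φ or ψ)  = time-poly φ +-poly (const-poly 2 +-poly (const-poly 1 +-poly time-poly ψ))
  time-poly (some {d = d} p q φ) =
    const-poly (setTime d ⌞ wk p ⌟) +-poly (const-poly (setTime d ⌞ wk q ⌟) +-poly (const-poly 2 +-poly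
      (f-poly *-poly (const-poly 2 +-poly (time-poly φ +-poly const-poly 8)) +-poly const-poly 2)))

  buildTime-poly : ∀ φ → IsPolynomial (λ x → buildTime φ (f x))
  buildTime-poly φ = const-poly 2 +-poly (const-poly 2 +-poly
    (f-poly *-poly (const-poly 2 +-poly (time-poly φ +-poly const-poly 11)) +-poly const-poly 2))

  whenTime-poly : ∀ φ e → IsPolynomial (λ x → whenTime φ e (f x))
  whenTime-poly φ e = time-poly φ +-poly (const-poly 2 +-poly const-poly (setTime 8 e))

  visitTime-poly : IsPolynomial (λ x → visitTime (f x))
  visitTime-poly =
    let p , p≡ = const-poly 16 +-poly (buildTime-poly exchangeΦ +-poly
                   (whenTime-poly clashΦ (push chosenPath) +-poly whenTime-poly canonicalΦ (push (var 4F))))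
    in p , λ x → trans (p≡ x) (cong (16 +_) (sym (expandTime-≡ (f x))))

  initialTime-poly : IsPolynomial (λ x → initialTime (f x))
  initialTime-poly =
    let p , p≡ = const-poly 3 +-poly (const-poly 3 +-poly (buildTime-poly emptyΦ +-poly
                   const-poly (setTime 8 rootStack)))
    in p , λ x → trans (p≡ x) (sym (initialTime-≡ (f x)))

-- `s` is for the two families and `2 * s` for the chosen set: the latter takes up to 4 tree nodes
-- per argument, whereas the attack matrix contributes at least 2 per argument to the input size.
nodeBound : ℕ → ℕ
nodeBound s = 3 + (s + 2 * s)

abstract
  -- The factor `s` exceeds the number of irreducible sets and thus bounds the number of levels,
  -- hence both the pending nodes and the visits between outputs. The 3 covers a truth value and the
  -- empty stack; `initialTime` falls due before the first output.
  sizeBound delayBound : ℕ → ℕ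
  sizeBound s  = 3 + s * nodeBound s
  delayBound s = initialTime (sizeBound s) + s * visitTime (sizeBound s)

  sizeBound-≡ : ∀ s → sizeBound s ≡ 3 + s * nodeBound s
  sizeBound-≡ s = refl

  delayBound-≡ : ∀ s → delayBound s ≡ initialTime (sizeBound s) + s * visitTime (sizeBound s)
  delayBound-≡ s = refl

  sizeBound-poly : IsPolynomial sizeBound
  sizeBound-poly =
    const-poly 3 +-poly id-poly *-poly (const-poly 3 +-poly (id-poly +-poly const-poly 2 *-poly id-poly))

  delayBound-poly : IsPolynomial delayBound
  delayBound-poly = initialTime-poly sizeBound-poly +-poly id-poly *-poly visitTime-poly sizeBound-poly

encodeList-size : ∀ ds → 1 + 2 * length ds ≤ ∣ encodeList ds ∣
encodeList-size []       = ≤-refl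
encodeList-size (d ∷ ds) = ≤-trans
  (≤-reflexive (solve 1 (λ l → con 1 :+ con 2 :* (con 1 :+ l) := con 1 :+ (con 1 :+ (con 1 :+ con 2 :* l))) refl (length ds)))
  (s≤s (+-mono-≤ (size-pos d) (encodeList-size ds)))
  where
  open +-*-Solver
  size-pos : ∀ d → 1 ≤ ∣ d ∣
  size-pos nil        = ≤-refl
  size-pos (cons _ _) = s≤s z≤n

-- The run on a given input

module Enumeration (X : AFWithIrr) where
  open AFWithIrr X
  open AF F
  open EnumerationProblem PrefFromIrr using (encodeInput; inputSize)
  open Preferences F using (leaves; maximal-[]; leaves-list-preferred)

  ∅ : Subset n
  ∅ = ⊥

  s B : ℕ
  s = inputSize X
  B = sizeBound s

  rows-size : 1 + 2 * n ≤ ∣ encodeAF F ∣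
  rows-size = subst (λ l → 1 + 2 * l ≤ ∣ encodeAF F ∣)
    (trans (length-map encodeSubset (toList attackedBy)) (length-toList attackedBy))
    (encodeList-size (map encodeSubset (toList attackedBy)))

  irr-size : 1 + 2 * length irr ≤ ∣ encodeFamily irr ∣
  irr-size = subst (λ l → 1 + 2 * l ≤ ∣ encodeFamily irr ∣) (length-map encodeSubset irr)
    (encodeList-size (map encodeSubset irr))

  rows≤s : ∣ encodeAF F ∣ ≤ s
  rows≤s = ≤-trans (m≤m+n _ _) (n≤1+n _)

  irr≤s : 1 + ∣ encodeFamily irr ∣ ≤ s
  irr≤s = s≤s (m≤n+m _ ∣ encodeAF F ∣)

  length-irr<s : 1 + length irr ≤ s
  length-irr<s = ≤-trans (+-monoʳ-≤ 1 (m≤m+n (length irr) _)) (≤-trans irr-size (≤-trans (n≤1+n _) irr≤s))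

  1≤s : 1 ≤ s
  1≤s = s≤s z≤n

  bits≤2s : 1 + n * 4 ≤ 2 * s
  bits≤2s = ≤-trans (≤-trans (n≤1+n _) (≤-reflexive
      (solve 1 (λ n → con 2 :+ n :* con 4 := con 2 :* (con 1 :+ con 2 :* n)) refl n)))
    (*-monoʳ-≤ 2 (≤-trans rows-size rows≤s))
    where open +-*-Solver

  nodeBound≤B : nodeBound s ≤ B
  nodeBound≤B = ≤-trans (≤-reflexive (sym (*-identityˡ (nodeBound s))))
    (≤-trans (*-monoˡ-≤ (nodeBound s) 1≤s) (≤-trans (m≤n+m _ 3) (≤-reflexive (sym (sizeBound-≡ s)))))

  s≤B : s ≤ B
  s≤B = ≤-trans (≤-trans (m≤m+n s _) (m≤n+m _ 3)) nodeBound≤B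

  bits≤B : 1 + n * 4 ≤ B
  bits≤B = ≤-trans bits≤2s (≤-trans (≤-trans (m≤n+m _ s) (m≤n+m _ 3)) nodeBound≤B)

  3≤B : 3 ≤ B
  3≤B = ≤-trans (m≤m+n 3 (s * nodeBound s)) (≤-reflexive (sym (sizeBound-≡ s)))

  open Bounded B 3≤B
  open Search F B 3≤B (≤-trans rows≤s s≤B) bits≤B
    (≤-trans (≤-trans (m≤m+n n (n + 0)) (n≤1+n _)) (≤-trans (≤-trans rows-size rows≤s) s≤B))
  open Delay (delayBound s)

  emptyStack-fits : ∣ nil ∣ + (1 + length irr) * nodeBound s ≤ B
  emptyStack-fits = ≤-trans (+-mono-≤ {1} {3} (s≤s z≤n) (*-monoˡ-≤ (nodeBound s) length-irr<s))
                            (≤-reflexive (sym (sizeBound-≡ s)))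

  family-fits : ∣ encodeFamily {n} [] ∣ + ∣ encodeFamily irr ∣ ≤ s
  family-fits = irr≤s

  node-fits : 3 + (s + (1 + n * 4)) ≤ nodeBound s
  node-fits = +-monoʳ-≤ 3 (+-monoʳ-≤ s bits≤2s)

  initialise-runs : Reaches initialise (state (encodeInput X) (replicate 8 nil) (replicate 5 nil))
    (vars (cons (node [] ∅ irr) nil) nil nil (encodeSubset ∅)) (initialTime B)
  initialise-runs =
    let r , σ , small-r , small-σ , run =
          build-runs emptyΦ ∅ {encodeFamily irr} {nil} small-irr small-nil
            (λ _ _ → means (mk⇔ (λ ≢nil → contradiction refl ≢nil) (λ x∈ → contradiction x∈ ∉⊥)))
            {encodeInput X} {replicate 8 nil} {nil} {nil} s≤B nils small-nil small-nil
    in r , σ , small-r , small-σ , runs-≤ (≤-reflexive (sym (initialTime-≡ B)))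
       (load-irr ▷ load-rows ▷ run ▷
        runs-set {r = r} {σ} {vars (encodeFamily irr) nil nil (encodeSubset ∅)} 1F rootStack small-r small-σ
          (smalls small-irr small-nil small-nil (small-subset ∅)) refl small-root)
    where
    nils : All Small (replicate 8 nil)
    nils = small-nil ∷ small-nil ∷ small-nil ∷ small-nil ∷ small-nil ∷ small-nil ∷ small-nil ∷ small-nil ∷ []
    small-irr : Small (encodeFamily irr)
    small-irr = ≤-trans (n≤1+n _) (≤-trans irr≤s s≤B)
    small-root : Small (cons (node [] ∅ irr) nil)
    small-root = ≤-trans (m≤m+n _ _)
      (stack-size s (nodeBound s) node-fits {[]} {∅} {irr} {length irr} {nil} family-fits emptyStack-fits)

    load-irr : Runs (suc (place 8 1F) ≔ `tl (var zero))
      (state (encodeInput X) (replicate 8 nil) (replicate 5 nil))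
      (state (encodeInput X) (replicate 8 nil) (nil ∷ encodeFamily irr ∷ nil ∷ nil ∷ nil ∷ [])) 3
    load-irr = runs-assign {e = `tl (var zero)}
      (s≤B ∷ All-fill nils (small-nil ∷ small-nil ∷ small-nil ∷ small-nil ∷ small-nil ∷ [])) refl small-irr
    load-rows : Runs (suc (place 8 0F) ≔ `hd (var zero))
      (state (encodeInput X) (replicate 8 nil) (nil ∷ encodeFamily irr ∷ nil ∷ nil ∷ nil ∷ []))
      (state (encodeInput X) (replicate 8 nil) (vars (encodeFamily irr) nil nil nil)) 3
    load-rows = runs-assign {e = `hd (var zero)}
      (s≤B ∷ All-fill nils (small-nil ∷ small-irr ∷ small-nil ∷ small-nil ∷ small-nil ∷ [])) refl (≤-trans rows≤s s≤B)

  solutions : List (Subset n)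
  solutions = leaves [] ∅ irr

  RunsWell : Cmd 14 → Store 14 → List 𝔻 → ℕ → Set
  RunsWell c σ ys b = ∃[ τ ] ∃[ σ′ ] (⟨ c , σ ⟩⇓⟨ τ , σ′ ⟩ × Good ys b τ)

  compose : ∀ {c d σ σ′ ys t} → Runs c σ σ′ t → RunsWell d σ′ ys t → RunsWell (c ⨾ d) σ ys 0
  compose (τ , run , silent) (τ′ , σ′ , run′ , good) = τ ++ τ′ , σ′ , ⇓-seq run run′ , good-++ silent ≤-refl good

  then-search : ∀ {c σ stack b ys} → Reaches c σ (vars stack nil nil (encodeSubset ∅)) b → Empties b stack ys →
                RunsWell (c ⨾ search) σ ys 0
  then-search {c} {stack = stack} (r , s₁ , small-r , small-s₁ , run) (empties searching) =
    compose {c} {search} {σ′ = state r s₁ (vars stack nil nil (encodeSubset ∅))} run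
      (searching {r} {s₁} {nil} {nil} {encodeSubset ∅} small-r small-s₁ small-nil small-nil (small-subset ∅))

  program-runs : RunsWell (initialise ⨾ search) (encodeInput X ∷ replicate 13 nil) (map encodeSubset solutions) 0
  program-runs = then-search initialise-runs searching
    where
    budget : initialTime B + (1 + length irr) * T ≤ delayBound s
    budget = ≤-trans (+-monoʳ-≤ (initialTime B) (*-monoˡ-≤ T length-irr<s))
                     (≤-reflexive (sym (delayBound-≡ s)))
    finished : Empties 0 nil []
    finished = empties-nil (≤-trans (≤-trans (m≤m+n 2 _) (m≤m+n T (length irr * T))) (≤-trans (m≤n+m _ (initialTime B)) budget))
    searching : Empties (initialTime B) (cons (node [] ∅ irr) nil) (map encodeSubset solutions)
    searching = subst (Empties (initialTime B) (cons (node [] ∅ irr) nil)) (++-identityʳ (map encodeSubset solutions))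
      (empties-leaves s (nodeBound s) node-fits irr {[]} {∅} {nil} {[]} {initialTime B}
        maximal-[] family-fits emptyStack-fits budget finished)

  every-run-good : ∀ {τ} → program on encodeInput X ⇓ τ → Good (map encodeSubset solutions) 0 τ
  every-run-good (_ , run) = transfer program-runs run
    where
    transfer : ∀ {c σ σ′ ys b τ} → RunsWell c σ ys b → ⟨ c , σ ⟩⇓⟨ τ , σ′ ⟩ → Good ys b τ
    transfer (_ , _ , run′ , good) run = subst (Good _ _) (proj₁ (⇓-deterministic run′ run)) good

  enumerated : ∃[ τ ] (program on encodeInput X ⇓ τ ×
    ∃[ Ss ] (Ss Lists Preferred × outputs τ ≡ map encodeSubset Ss))
  enumerated = conclude program-runs
    where
    conclude : RunsWell (initialise ⨾ search) (encodeInput X ∷ replicate 13 nil) (map encodeSubset solutions) 0 → _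
    conclude (τ , σ , run , good) = τ , (σ , run) , solutions , leaves-list-preferred irr-lists , good-outputs good

  delays-bounded : ∀ {τ} → program on encodeInput X ⇓ τ → List.All (_≤ delayBound s) (delays τ)
  delays-bounded run = good-delays (every-run-good run) z≤n

  spaces-bounded : ∀ {τ} → program on encodeInput X ⇓ τ → List.All (_≤ 14 * B + B) (spaces τ)
  spaces-bounded run = good-spaces (every-run-good run)

corollary1 : Σ[ P ∈ Program ]
    (Enumerates P PrefFromIrr × PolynomialDelay P PrefFromIrr × PolynomialSpace P PrefFromIrr)
corollary1 = program , Enumeration.enumerated , delay , space
  where
  delay : PolynomialDelay program PrefFromIrr
  delay = let p , p≡ = delayBound-poly in
    p , λ X τ run → subst (λ b → List.All (_≤ b) (delays τ)) (sym (p≡ _)) (Enumeration.delays-bounded X run)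
  space : PolynomialSpace program PrefFromIrr
  space = let p , p≡ = const-poly 14 *-poly sizeBound-poly +-poly sizeBound-poly in
    p , λ X τ run → subst (λ b → List.All (_≤ b) (spaces τ)) (sym (p≡ _)) (Enumeration.spaces-bounded X run)
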